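{- There exist a constant $\alpha>1.587$ and a function $\varepsilon(n)\to 0$ as $n\to\infty$ such that for every positive integer $n$, \[Q(n)\le \left((1+\varepsilon(n))\frac{n}{e^{\alpha}}\right)^{n}.\]
   Context: $Q(n)$ denotes the number of ways to place $n$ queens on the (ordinary, non-toroidal) $n\times n$ chessboard with squares $(i,j)$, $1\le i,j\le n$, so that no two queens share a row, a column, or a diagonal (a set of squares with $i-j$ constant or with $i+j$ constant). -}

module Defs where

open import Data.Bool using (Bool; true; false; _∧_; not; T?)
open import Data.Nat using (ℕ; zero; suc; _+_; _≡ᵇ_)
open import Data.Product using (_×_; _,_)
open import Data.Fin using (Fin; toℕ)
open import Data.List using (List; []; _∷_; length; filter; map; concatMap; allFin; zip; upTo)
open import Data.Vec using (Vec; []; _∷_; toList)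
open import Data.Integer using (+_)
open import Data.Rational using (ℚ; _/_; 1ℚ; 0ℚ) renaming (_*_ to _*ℚ_; _+_ to _+ℚ_)

-- n-queens count Q(n).
-- A placement of n queens with no two in the same row is given by a
-- vector v : Vec (Fin n) n, the queen of row i (0-based) sitting in
-- column v[i]. Q(n) counts such vectors where no two queens share a
-- column or a diagonal (i - j constant, or i + j constant).

-- Queens at (row i , col a) and (row j , col b), with i ≠ j, do not attack.
nonAttacking : ℕ × ℕ → ℕ × ℕ → Bool
nonAttacking (i , a) (j , b) =
  not (a ≡ᵇ b) ∧ not ((i + b) ≡ᵇ (j + a)) ∧ not ((i + a) ≡ᵇ (j + b))

allB : {A : Set} → (A → Bool) → List A → Bool
allB f []       = true
allB f (x ∷ xs) = f x ∧ allB f xs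

pairwiseOK : List (ℕ × ℕ) → Bool
pairwiseOK []       = true
pairwiseOK (p ∷ ps) = allB (nonAttacking p) ps ∧ pairwiseOK ps

queenSquares : ∀ {n} → Vec (Fin n) n → List (ℕ × ℕ)
queenSquares {n} v = zip (upTo n) (map toℕ (toList v))

isSolution : ∀ {n} → Vec (Fin n) n → Bool
isSolution v = pairwiseOK (queenSquares v)

allVecs : (n k : ℕ) → List (Vec (Fin n) k)
allVecs n zero    = [] ∷ []
allVecs n (suc k) = concatMap (λ x → map (x ∷_) (allVecs n k)) (allFin n)

Q : ℕ → ℕ
Q n = length (filter (λ v → T? (isSolution v)) (allVecs n n))

ℕ→ℚ : ℕ → ℚ
ℕ→ℚ m = (+ m) / 1

-- k-th partial sum of the exponential series at a natural x:
-- expPartial x k = Σ_{j < k} x^j / j!.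
-- For x ≥ 0, e^x is the supremum of these partial sums, so
-- "e^x ≤ A" is expressed as "∀ k → expPartial x k ≤ A".
expTerm : ℕ → ℕ → ℚ
expTerm x zero    = 1ℚ
expTerm x (suc j) = expTerm x j *ℚ ((+ x) / suc j)

expPartial : ℕ → ℕ → ℚ
expPartial x zero    = 0ℚ
expPartial x (suc k) = expPartial x k +ℚ expTerm x k

-- The proof is Luria's entropy argument with all logarithms removed. Reveal the rows of a
-- solution in a fixed order; the chain rule says that |W|^|W| is at most the product over the
-- solutions W of the numbers of columns that are still free at each step. Multiply over all
-- n! orders and apply AM-GM level by level: what remains is, for each solution, the average
-- number of free squares when l rows are left. A square with d ∈ {0,1,2} occupied diagonals is
-- free with probability about (l/n)^{2+d}, which is convex in d, so only the total ∑ d matters.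
-- The queen at (r , a) covers 2n - max(|r - r'| , |a - a'|) diagonal squares, where ' is
-- reflection; since rows and columns are each used once, ∑ d ≥ 5n²/4. Hence Q(n) is at most
-- ∏_{l ≤ n} (l + 3)(3 + 5(l/n)²)/8, which is (n e^{-α+o(1)})ⁿ for
-- α = 3 - 2 arctan(√(5/3)) / √(5/3) = 1.58754… Because α > 4650/2930 > 1.587, there is room
-- to estimate the product by L = 2930 blocks and to drop ε(n) altogether.
module Submission where

open import Defs
open import Data.Nat using (ℕ; suc; _*_; _<_; _≤_; _^_)
open import Data.Product using (Σ; ∃; _×_)
open import Data.Rational using () renaming (_*_ to _*ℚ_; _≤_ to _≤ℚ_)

open import Algebra.Bundles using (CommutativeMonoid)
open import Algebra.Properties.CommutativeSemigroup using (interchange)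
open import Data.Bool using (Bool; true; false; _∧_; not; T; T?)
open import Data.Empty using (⊥; ⊥-elim)
open import Data.Fin using (Fin; zero; suc; toℕ; fromℕ<; opposite)
open import Data.Fin.Properties using (_≟_; toℕ-fromℕ<; opposite-prop; toℕ<n; opposite-involutive; toℕ-injective)
  renaming (suc-injective to Fin-suc-injective)
import Data.Integer as ℤ
import Data.Integer.Properties as ℤ
open import Data.List using (List; []; _∷_; _++_; length; map; concatMap; allFin; tabulate; filter; replicate; applyUpTo; zip)
open import Data.List.Membership.Propositional using (_∈_; find)
open import Data.List.Membership.Propositional.Properties using (∈-filter⁻; ∈-map⁻; ∈-concatMap⁻; ∈-allFin)
open import Data.List.Properties using (length-++; length-replicate; length-tabulate)
open import Data.List.Relation.Binary.Permutation.Propositional as ↭ using (_↭_; ↭-sym)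
open import Data.List.Relation.Binary.Permutation.Propositional.Properties using (∈-resp-↭)
import Data.List.Relation.Binary.Permutation.Setoid.Properties as ↭ₛ
import Data.List.Relation.Unary.All as All
import Data.List.Relation.Unary.All.Properties as All
import Data.List.Relation.Unary.AllPairs as AllPairs
import Data.List.Relation.Unary.AllPairs.Properties as AllPairs
open import Data.List.Relation.Unary.Any using (here; there)
open import Data.List.Relation.Unary.Unique.Propositional using (Unique; []; _∷_)
open import Data.List.Relation.Unary.Unique.Propositional.Properties using (allFin⁺; concat⁺; map⁺; filter⁺)
open import Data.Nat hiding (_≟_; _/_; _%_)
open import Data.Nat.DivMod using (_/_; _%_; m≡m%n+[m/n]*n; m%n<n; /-monoˡ-≤; m*n/n≡m)
open import Data.Nat.Properties hiding (_≟_)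
open import Data.Nat.Tactic.RingSolver using (solve-∀)
open import Data.Product using (_,_; proj₁; proj₂; map₂)
open import Data.Rational as ℚ using (toℚᵘ)
import Data.Rational.Properties as ℚ
open import Data.Rational.Unnormalised as ℚᵘ using (mkℚᵘ; *≡*; *≤*)
import Data.Rational.Unnormalised.Properties as ℚᵘ
open import Data.Sum using (_⊎_; inj₁; inj₂)
open import Data.Unit using (⊤)
open import Data.Vec as Vec using (Vec; []; _∷_; toList; lookup)
open import Data.Vec.Properties using (∷-injectiveˡ; ∷-injectiveʳ)
open import Function using (_∘_; id)
open import Level using (0ℓ)
open import Relation.Binary.Definitions using (tri<; tri≈; tri>)
open import Relation.Binary.PropositionalEquality
open import Relation.Nullary using (does; yes; no)
open import Relation.Unary using (Pred; Decidable)

-- The obstacle in ∑ d is that the loss max(p , q) of a queen, with p = |r - r'| and q = |a - a'|,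
-- couples its row and its column. It is decoupled by max(p , q) ≤ max(p , h) + max(q , h) - h at h
-- = n/2, the median of p and hence the best threshold. The mean of max(p , h) is about 5n/8, so the
-- mean loss is at most about 3n/4 and ∑ d is at least 2n² - 3n²/4. A square that carries a queen
-- lies on all lines of that queen at once and escapes the estimate by d; there are only n such
-- squares, and they account for the 3 in l + 3. The constants: the block product is an upper
-- Riemann sum, whose logarithm is too large by about ln(8/3) / 2 ≈ 0.49, and a further ln 2 is
-- reserved so that 2^(n/L) absorbs all polynomial factors. Hence L (α - 1) - r has to exceed about
-- 1.18 although r / L > 0.587, which forces L into the thousands; L = 2930 and r = 1720 leave about
-- 0.3, of which replacing e by 1699/625 costs less than 0.08.

private variable
  A B : Set

-- Rearranging sums, products and powers

+-interchange : ∀ a b c d → (a + b) + (c + d) ≡ (a + c) + (b + d)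
+-interchange = interchange +-commutativeSemigroup

*-interchange : ∀ a b c d → (a * b) * (c * d) ≡ (a * c) * (b * d)
*-interchange = interchange *-commutativeSemigroup

^-distribʳ-* : ∀ a b n → (a * b) ^ n ≡ a ^ n * b ^ n
^-distribʳ-* a b zero = refl
^-distribʳ-* a b (suc n) = trans (cong (a * b *_) (^-distribʳ-* a b n)) (*-interchange a b (a ^ n) (b ^ n))

^-cancelʳ-≤ : ∀ a b n → 0 < n → a ^ n ≤ b ^ n → a ≤ b
^-cancelʳ-≤ a b n 0<n le with a ≤? b
... | yes p = p
... | no ¬p = ⊥-elim (<⇒≱ (^-monoˡ-< n {{>-nonZero 0<n}} (≰⇒> ¬p)) le)

-- Sums and products over lists

∑ ∏ : List A → (A → ℕ) → ℕ
∑ [] f = 0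
∑ (x ∷ xs) f = f x + ∑ xs f
∏ [] f = 1
∏ (x ∷ xs) f = f x * ∏ xs f

∑-mono : ∀ (xs : List A) {f g} → (∀ {x} → x ∈ xs → f x ≤ g x) → ∑ xs f ≤ ∑ xs g
∑-mono [] le = z≤n
∑-mono (x ∷ xs) le = +-mono-≤ (le (here refl)) (∑-mono xs (le ∘ there))

∑-cong : ∀ (xs : List A) {f g} → (∀ {x} → x ∈ xs → f x ≡ g x) → ∑ xs f ≡ ∑ xs g
∑-cong [] eq = refl
∑-cong (x ∷ xs) eq = cong₂ _+_ (eq (here refl)) (∑-cong xs (eq ∘ there))

∑-distrib-+ : ∀ (xs : List A) f g → ∑ xs (λ x → f x + g x) ≡ ∑ xs f + ∑ xs g
∑-distrib-+ [] f g = refl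
∑-distrib-+ (x ∷ xs) f g = trans (cong (f x + g x +_) (∑-distrib-+ xs f g)) (+-interchange (f x) _ _ _)

∑-const : ∀ (xs : List A) c → ∑ xs (λ _ → c) ≡ length xs * c
∑-const [] c = refl
∑-const (x ∷ xs) c = cong (c +_) (∑-const xs c)

∑-*ˡ : ∀ (xs : List A) c f → ∑ xs (λ x → c * f x) ≡ c * ∑ xs f
∑-*ˡ [] c f = sym (*-zeroʳ c)
∑-*ˡ (x ∷ xs) c f = trans (cong (c * f x +_) (∑-*ˡ xs c f)) (sym (*-distribˡ-+ c _ _))

∑-*ʳ : ∀ (xs : List A) c f → ∑ xs (λ x → f x * c) ≡ ∑ xs f * c
∑-*ʳ xs c f = trans (∑-cong xs (λ {x} _ → *-comm (f x) c)) (trans (∑-*ˡ xs c f) (*-comm c _))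

∑-swap : ∀ (xs : List A) (ys : List B) (f : A → B → ℕ) → ∑ xs (λ x → ∑ ys (f x)) ≡ ∑ ys (λ y → ∑ xs (λ x → f x y))
∑-swap [] ys f = sym (trans (∑-const ys 0) (*-zeroʳ (length ys)))
∑-swap (x ∷ xs) ys f = trans (cong (∑ ys (f x) +_) (∑-swap xs ys f)) (sym (∑-distrib-+ ys _ _))

∑-++ : ∀ (xs ys : List A) f → ∑ (xs ++ ys) f ≡ ∑ xs f + ∑ ys f
∑-++ [] ys f = refl
∑-++ (x ∷ xs) ys f = trans (cong (f x +_) (∑-++ xs ys f)) (sym (+-assoc (f x) _ _))

∑-map : ∀ (g : A → B) xs f → ∑ (map g xs) f ≡ ∑ xs (f ∘ g)
∑-map g [] f = refl
∑-map g (x ∷ xs) f = cong (f (g x) +_) (∑-map g xs f)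

∑-concatMap : ∀ (g : A → List B) xs f → ∑ (concatMap g xs) f ≡ ∑ xs (λ x → ∑ (g x) f)
∑-concatMap g [] f = refl
∑-concatMap g (x ∷ xs) f = trans (∑-++ (g x) (concatMap g xs) f) (cong (∑ (g x) f +_) (∑-concatMap g xs f))

∑-tabulate : ∀ {n} (h : A → B) (g : Fin n → A) f → ∑ (tabulate (h ∘ g)) f ≡ ∑ (tabulate g) (f ∘ h)
∑-tabulate {n = zero} h g f = refl
∑-tabulate {n = suc n} h g f = cong (f (h (g zero)) +_) (∑-tabulate h (g ∘ suc) f)

∑-allFin-suc : ∀ n f → ∑ (allFin (suc n)) f ≡ f zero + ∑ (allFin n) (f ∘ suc)
∑-allFin-suc n f = cong (f zero +_) (∑-tabulate suc id f)

∏-mono : ∀ (xs : List A) {f g} → (∀ {x} → x ∈ xs → f x ≤ g x) → ∏ xs f ≤ ∏ xs g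
∏-mono [] le = ≤-refl
∏-mono (x ∷ xs) le = *-mono-≤ (le (here refl)) (∏-mono xs (le ∘ there))

∏-cong : ∀ (xs : List A) {f g} → (∀ {x} → x ∈ xs → f x ≡ g x) → ∏ xs f ≡ ∏ xs g
∏-cong [] eq = refl
∏-cong (x ∷ xs) eq = cong₂ _*_ (eq (here refl)) (∏-cong xs (eq ∘ there))

∏-distrib-* : ∀ (xs : List A) f g → ∏ xs (λ x → f x * g x) ≡ ∏ xs f * ∏ xs g
∏-distrib-* [] f g = refl
∏-distrib-* (x ∷ xs) f g = trans (cong (f x * g x *_) (∏-distrib-* xs f g)) (*-interchange (f x) _ _ _)

∏-const : ∀ (xs : List A) c → ∏ xs (λ _ → c) ≡ c ^ length xs
∏-const [] c = refl
∏-const (x ∷ xs) c = cong (c *_) (∏-const xs c)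

∏-^ : ∀ (xs : List A) k f → ∏ xs (λ x → f x ^ k) ≡ ∏ xs f ^ k
∏-^ [] k f = sym (^-zeroˡ k)
∏-^ (x ∷ xs) k f = trans (cong (f x ^ k *_) (∏-^ xs k f)) (sym (^-distribʳ-* (f x) _ k))

∏-^-∑ : ∀ (xs : List A) a f → ∏ xs (λ x → a ^ f x) ≡ a ^ ∑ xs f
∏-^-∑ [] a f = refl
∏-^-∑ (x ∷ xs) a f = trans (cong (a ^ f x *_) (∏-^-∑ xs a f)) (sym (^-distribˡ-+-* a (f x) _))

∏-swap : ∀ (xs : List A) (ys : List B) (f : A → B → ℕ) → ∏ xs (λ x → ∏ ys (f x)) ≡ ∏ ys (λ y → ∏ xs (λ x → f x y))
∏-swap [] ys f = sym (trans (∏-const ys 1) (^-zeroˡ (length ys)))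
∏-swap (x ∷ xs) ys f = trans (cong (∏ ys (f x) *_) (∏-swap xs ys f)) (sym (∏-distrib-* ys _ _))

∏-tabulate : ∀ {n} (h : A → B) (g : Fin n → A) f → ∏ (tabulate (h ∘ g)) f ≡ ∏ (tabulate g) (f ∘ h)
∏-tabulate {n = zero} h g f = refl
∏-tabulate {n = suc n} h g f = cong (f (h (g zero)) *_) (∏-tabulate h (g ∘ suc) f)

∏-allFin-suc : ∀ n f → ∏ (allFin (suc n)) f ≡ f zero * ∏ (allFin n) (f ∘ suc)
∏-allFin-suc n f = cong (f zero *_) (∏-tabulate suc id f)

𝟙 : Bool → ℕ
𝟙 true = 1
𝟙 false = 0

-- The inequality of arithmetic and geometric means

2xy≤x²+y² : ∀ x y → 2 * (x * y) ≤ x * x + y * y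
2xy≤x²+y² x y with ≤-total x y
... | inj₁ x≤y with d , refl ← m≤n⇒∃[o]m+o≡n x≤y =
  ≤-trans (m≤m+n _ (d * d)) (≤-reflexive (eq x d))
  where
  eq : ∀ x d → 2 * (x * (x + d)) + d * d ≡ x * x + (x + d) * (x + d)
  eq = solve-∀
... | inj₂ y≤x with d , refl ← m≤n⇒∃[o]m+o≡n y≤x =
  ≤-trans (m≤m+n _ (d * d)) (≤-reflexive (eq y d))
  where
  eq : ∀ y d → 2 * ((y + d) * y) + d * d ≡ (y + d) * (y + d) + y * y
  eq = solve-∀

-- The convex function x^(n+1) lies above its tangent at y; AM-GM and the bounds on e both rest on
-- this. In the induction a multiple of x y^(n+1) is added to both sides, so that no subtraction
-- occurs.
power-tangent : ∀ n x y → suc n * (x * y ^ n) ≤ x ^ suc n + n * y ^ suc n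
power-tangent zero x y = ≤-reflexive (eq x)
  where
  eq : ∀ x → 1 * (x * 1) ≡ x * 1 + 0
  eq = solve-∀
power-tangent (suc n) x y = +-cancelʳ-≤ (n * (x * (y * y ^ n))) _ _ (begin
  (2 + n) * (x * (y * y ^ n)) + n * (x * (y * y ^ n))   ≡⟨ eq₁ n x y (y ^ n) ⟩
  (1 + n) * y ^ n * (2 * (x * y))                       ≤⟨ *-monoʳ-≤ ((1 + n) * y ^ n) (2xy≤x²+y² x y) ⟩
  (1 + n) * y ^ n * (x * x + y * y)                     ≡⟨ eq₂ n x y (y ^ n) ⟩
  x * ((1 + n) * (x * y ^ n)) + (1 + n) * (y * (y * y ^ n))
    ≤⟨ +-monoˡ-≤ _ (*-monoʳ-≤ x (power-tangent n x y)) ⟩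
  x * (x * x ^ n + n * (y * y ^ n)) + (1 + n) * (y * (y * y ^ n))
    ≡⟨ eq₃ n x y (x ^ n) (y ^ n) ⟩
  x * (x * x ^ n) + (1 + n) * (y * (y * y ^ n)) + n * (x * (y * y ^ n)) ∎)
  where
  open ≤-Reasoning
  eq₁ : ∀ n x y z → (2 + n) * (x * (y * z)) + n * (x * (y * z)) ≡ (1 + n) * z * (2 * (x * y))
  eq₁ = solve-∀
  eq₂ : ∀ n x y z → (1 + n) * z * (x * x + y * y) ≡ x * ((1 + n) * (x * z)) + (1 + n) * (y * (y * z))
  eq₂ = solve-∀
  eq₃ : ∀ n x y w z → x * (x * w + n * (y * z)) + (1 + n) * (y * (y * z))
        ≡ x * (x * w) + (1 + n) * (y * (y * z)) + n * (x * (y * z))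
  eq₃ = solve-∀

-- power-tangent at x = n(s + y) and y = (n+1)s, divided by n.
amgm-step : ∀ n s y → suc n ^ suc n * (s ^ n * y) ≤ n ^ n * (s + y) ^ suc n
amgm-step zero s y = ≤-trans (≤-reflexive (eq y)) (≤-trans (m≤n+m y s) (≤-reflexive (eq′ (s + y))))
  where
  eq : ∀ y → (1 * 1) * (1 * y) ≡ y
  eq = solve-∀
  eq′ : ∀ z → z ≡ 1 * (z * 1)
  eq′ = solve-∀
amgm-step n@(suc _) s y = *-cancelˡ-≤ n (+-cancelʳ-≤ (n * Y ^ suc n) _ _ (begin
  n * (suc n ^ suc n * (s ^ n * y)) + n * (Y * Y ^ n)
    ≡⟨ cong (λ z → n * (suc n ^ suc n * (s ^ n * y)) + n * (Y * z)) (^-distribʳ-* (suc n) s n) ⟩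
  n * ((1 + n) * (1 + n) ^ n * (s ^ n * y)) + n * ((1 + n) * s * ((1 + n) ^ n * s ^ n))
    ≡⟨ eq₁ n s y ((1 + n) ^ n) (s ^ n) ⟩
  (1 + n) * (n * (s + y) * ((1 + n) ^ n * s ^ n))
    ≡⟨ cong (λ z → suc n * (X * z)) (^-distribʳ-* (suc n) s n) ⟨
  suc n * (X * Y ^ n)  ≤⟨ power-tangent n X Y ⟩
  X ^ suc n + n * Y ^ suc n  ≡⟨ cong (_+ n * Y ^ suc n) (trans (^-distribʳ-* n (s + y) (suc n)) (*-assoc n (n ^ n) _)) ⟩
  n * (n ^ n * (s + y) ^ suc n) + n * Y ^ suc n ∎))
  where
  open ≤-Reasoning
  X = n * (s + y)
  Y = suc n * s
  eq₁ : ∀ n s y p q → n * ((1 + n) * p * (q * y)) + n * ((1 + n) * s * (p * q)) ≡ (1 + n) * (n * (s + y) * (p * q))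
  eq₁ = solve-∀

n^n>0 : ∀ n → 0 < n ^ n
n^n>0 zero = s≤s z≤n
n^n>0 n@(suc _) = m^n>0 n n

amgm : ∀ (xs : List A) f → length xs ^ length xs * ∏ xs f ≤ ∑ xs f ^ length xs
amgm [] f = ≤-refl
amgm (x ∷ xs) f = *-cancelˡ-≤ (n ^ n) {{>-nonZero (n^n>0 n)}} (begin
  n ^ n * (suc n ^ suc n * (y * P))     ≡⟨ eq (n ^ n) (suc n ^ suc n) y P ⟩
  suc n ^ suc n * (n ^ n * P * y)       ≤⟨ *-monoʳ-≤ (suc n ^ suc n) (*-monoˡ-≤ y (amgm xs f)) ⟩
  suc n ^ suc n * (S ^ n * y)           ≤⟨ amgm-step n S y ⟩
  n ^ n * (S + y) ^ suc n               ≡⟨ cong (λ z → n ^ n * z ^ suc n) (+-comm S y) ⟩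
  n ^ n * (y + S) ^ suc n               ∎)
  where
  open ≤-Reasoning
  n = length xs
  y = f x
  S = ∑ xs f
  P = ∏ xs f
  eq : ∀ a b y p → a * (b * (y * p)) ≡ b * (a * p * y)
  eq = solve-∀

-- Entropy

∑-replicate : ∀ k (a : ℕ) xs → ∑ (replicate k a ++ xs) id ≡ k * a + ∑ xs id
∑-replicate zero a xs = refl
∑-replicate (suc k) a xs = trans (cong (a +_) (∑-replicate k a xs)) (sym (+-assoc a _ _))

∏-replicate : ∀ k (a : ℕ) xs → ∏ (replicate k a ++ xs) id ≡ a ^ k * ∏ xs id
∏-replicate zero a xs = sym (*-identityˡ _)
∏-replicate (suc k) a xs = trans (cong (a *_) (∏-replicate k a xs)) (sym (*-assoc a _ _))

amgm₂ : ∀ c s a b → (c + s) ^ (c + s) * (a ^ c * b ^ s) ≤ (c * a + s * b) ^ (c + s)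
amgm₂ c s a b = subst₂ _≤_
  (cong₂ (λ l p → l ^ l * p) len (trans (∏-replicate c a _) (cong (a ^ c *_) (trans (∏-replicate s b []) (*-identityʳ _)))))
  (cong₂ _^_ (trans (∑-replicate c a _) (cong (c * a +_) (trans (∑-replicate s b []) (+-identityʳ _)))) len)
  (amgm xs id)
  where
  xs = replicate c a ++ replicate s b ++ []
  len : length xs ≡ c + s
  len = trans (length-++ (replicate c a)) (cong₂ _+_ (length-replicate c)
    (trans (length-++ (replicate s b)) (trans (+-identityʳ _) (length-replicate s))))

-- AM-GM for c copies of s and s copies of N c, whose sum is s c (N + 1). This is `log-sum` for one
-- value of weight c against N values of total weight s.
log-sum₂ : ∀ c s N → (c + s) ^ (c + s) * N ^ s ≤ c ^ c * s ^ s * suc N ^ (c + s)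
log-sum₂ zero s N = ≤-trans (*-monoʳ-≤ (s ^ s) (^-monoˡ-≤ s (n≤1+n N)))
  (≤-reflexive (cong (_* suc N ^ s) (sym (+-identityʳ (s ^ s)))))
log-sum₂ c@(suc _) zero N = subst₂ _≤_
  (cong (λ z → z ^ z * 1) (sym (+-identityʳ c)))
  (cong₂ (λ u v → u * suc N ^ v) (sym (*-identityʳ (c ^ c))) (sym (+-identityʳ c)))
  (*-monoʳ-≤ (c ^ c) (m^n>0 (suc N) c))
log-sum₂ c@(suc _) s@(suc _) N = *-cancelˡ-≤ (s ^ c * c ^ s) {{m*n≢0 _ _ {{m^n≢0 s c}} {{m^n≢0 c s}}}} (begin
  s ^ c * c ^ s * ((c + s) ^ (c + s) * N ^ s)    ≡⟨ eq (s ^ c) (c ^ s) ((c + s) ^ (c + s)) (N ^ s) ⟩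
  (c + s) ^ (c + s) * (s ^ c * (N ^ s * c ^ s))  ≡⟨ cong (λ z → (c + s) ^ (c + s) * (s ^ c * z)) (^-distribʳ-* N c s) ⟨
  (c + s) ^ (c + s) * (s ^ c * (N * c) ^ s)      ≤⟨ amgm₂ c s s (N * c) ⟩
  (c * s + s * (N * c)) ^ (c + s)                ≡⟨ cong (_^ (c + s)) (eq₂ c s N) ⟩
  (s * (c * suc N)) ^ (c + s)                    ≡⟨ trans (^-distribʳ-* s _ (c + s)) (cong (s ^ (c + s) *_) (^-distribʳ-* c (suc N) (c + s))) ⟩
  s ^ (c + s) * (c ^ (c + s) * suc N ^ (c + s))
    ≡⟨ cong₂ (λ u v → u * (v * suc N ^ (c + s))) (^-distribˡ-+-* s c s) (^-distribˡ-+-* c c s) ⟩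
  s ^ c * s ^ s * (c ^ c * c ^ s * suc N ^ (c + s)) ≡⟨ eq₃ (s ^ c) (s ^ s) (c ^ c) (c ^ s) _ ⟩
  s ^ c * c ^ s * (c ^ c * s ^ s * suc N ^ (c + s)) ∎)
  where
  open ≤-Reasoning
  eq : ∀ a b d e → a * b * (d * e) ≡ d * (a * (e * b))
  eq = solve-∀
  eq₂ : ∀ c s N → c * s + s * (N * c) ≡ s * (c * (1 + N))
  eq₂ = solve-∀
  eq₃ : ∀ a b d e f → a * b * (d * e * f) ≡ a * e * (d * b * f)
  eq₃ = solve-∀

-- The entropy of a distribution is at most the logarithm of the size of its support.
log-sum : ∀ (js : List A) (c : A → ℕ) (a : A → Bool) → (∀ j → a j ≡ false → c j ≡ 0) →
  ∑ js c ^ ∑ js c ≤ ∑ js (𝟙 ∘ a) ^ ∑ js c * ∏ js (λ j → c j ^ c j)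
log-sum [] c a supp = ≤-refl
log-sum (j ∷ js) c a supp with a j in aj
... | false rewrite supp j aj | +-identityʳ (∏ js (λ j → c j ^ c j)) = log-sum js c a supp
... | true = *-cancelˡ-≤ (N ^ S) {{>-nonZero N^S>0}} (begin
  N ^ S * (k + S) ^ (k + S)                     ≡⟨ *-comm (N ^ S) _ ⟩
  (k + S) ^ (k + S) * N ^ S                     ≤⟨ log-sum₂ k S N ⟩
  k ^ k * S ^ S * suc N ^ (k + S)               ≤⟨ *-monoˡ-≤ (suc N ^ (k + S)) (*-monoʳ-≤ (k ^ k) ih) ⟩
  k ^ k * (N ^ S * P) * suc N ^ (k + S)         ≡⟨ eq (k ^ k) (N ^ S) P (suc N ^ (k + S)) ⟩
  N ^ S * (suc N ^ (k + S) * (k ^ k * P))       ∎)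
  where
  open ≤-Reasoning
  k = c j
  S = ∑ js c
  N = ∑ js (𝟙 ∘ a)
  P = ∏ js (λ j → c j ^ c j)
  ih : S ^ S ≤ N ^ S * P
  ih = log-sum js c a supp
  N^S>0 : 0 < N ^ S
  -- If `N ^ S` vanished, so would `S ^ S`, but even 0 ^ 0 is 1.
  N^S>0 = n≢0⇒n>0 λ eq → <⇒≱ (n^n>0 S) (≤-trans ih (≤-reflexive (cong (_* P) eq)))
  eq : ∀ a b p d → a * (b * p) * d ≡ b * (d * (a * p))
  eq = solve-∀

length-filter-∑ : ∀ {P : Pred A 0ℓ} (P? : Decidable P) xs → length (filter P? xs) ≡ ∑ xs (𝟙 ∘ does ∘ P?)
length-filter-∑ P? [] = refl
length-filter-∑ P? (x ∷ xs) with does (P? x)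
... | true = cong suc (length-filter-∑ P? xs)
... | false = length-filter-∑ P? xs

∏-filter : ∀ {P : Pred A 0ℓ} (P? : Decidable P) xs f →
  ∏ (filter P? xs) f ≡ ∏ xs (λ x → f x ^ 𝟙 (does (P? x)))
∏-filter P? [] f = refl
∏-filter P? (x ∷ xs) f with does (P? x)
... | true = cong₂ _*_ (sym (*-identityʳ (f x))) (∏-filter P? xs f)
... | false = trans (∏-filter P? xs f) (sym (*-identityˡ _))

∑-indicator : ∀ {n} (i : Fin n) → ∑ (allFin n) (λ j → 𝟙 (does (i ≟ j))) ≡ 1
∑-indicator {suc n} zero = trans (∑-allFin-suc n (λ j → 𝟙 (does (zero ≟ j)))) (cong suc (trans (∑-const (allFin n) 0) (*-zeroʳ (length (allFin n)))))
∑-indicator {suc n} (suc i) = trans (∑-allFin-suc n (λ j → 𝟙 (does (suc i ≟ j)))) (∑-indicator i)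

∑-fibres : ∀ {n} (g : A → Fin n) xs → ∑ (allFin n) (λ j → length (filter (λ x → g x ≟ j) xs)) ≡ length xs
∑-fibres {n = n} g xs = begin
  ∑ (allFin n) (λ j → length (filter (λ x → g x ≟ j) xs))     ≡⟨ ∑-cong (allFin n) (λ {j} _ → length-filter-∑ (λ x → g x ≟ j) xs) ⟩
  ∑ (allFin n) (λ j → ∑ xs (λ x → 𝟙 (does (g x ≟ j))))        ≡⟨ ∑-swap (allFin n) xs _ ⟩
  ∑ xs (λ x → ∑ (allFin n) (λ j → 𝟙 (does (g x ≟ j))))        ≡⟨ ∑-cong xs (λ {x} _ → ∑-indicator (g x)) ⟩
  ∑ xs (λ _ → 1)                                              ≡⟨ trans (∑-const xs 1) (*-identityʳ _) ⟩
  length xs                                                   ∎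
  where open ≡-Reasoning

∏-fibres : ∀ {n} (g : A → Fin n) xs f → ∏ (allFin n) (λ j → ∏ (filter (λ x → g x ≟ j) xs) f) ≡ ∏ xs f
∏-fibres {n = n} g xs f = begin
  ∏ (allFin n) (λ j → ∏ (filter (λ x → g x ≟ j) xs) f)        ≡⟨ ∏-cong (allFin n) (λ {j} _ → ∏-filter (λ x → g x ≟ j) xs f) ⟩
  ∏ (allFin n) (λ j → ∏ xs (λ x → f x ^ 𝟙 (does (g x ≟ j))))  ≡⟨ ∏-swap (allFin n) xs _ ⟩
  ∏ xs (λ x → ∏ (allFin n) (λ j → f x ^ 𝟙 (does (g x ≟ j))))
    ≡⟨ ∏-cong xs (λ {x} _ → trans (∏-^-∑ (allFin n) (f x) _) (trans (cong (f x ^_) (∑-indicator (g x))) (*-identityʳ _))) ⟩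
  ∏ xs f ∎
  where open ≡-Reasoning

module Entropy {A I : Set} {n : ℕ} (x : A → I → Fin n) (free : A → List I → I → Fin n → Bool) where

  choices : ∀ {m} → A → List I → Vec I m → Fin m → ℕ
  choices v E (r ∷ σ) zero = ∑ (allFin n) (𝟙 ∘ free v E r)
  choices v E (r ∷ σ) (suc k) = choices v (r ∷ E) σ k

  Valid : ∀ {m} → A → List I → Vec I m → Set
  Valid v E [] = ⊤
  Valid v E (r ∷ σ) = free v E r (x v r) ≡ true × Valid v (r ∷ E) σ

  Agree : List I → A → A → Set
  Agree E v v′ = ∀ {r} → r ∈ E → x v r ≡ x v′ r

  module _ (free-cong : ∀ {v v′ E} r j → Agree E v v′ → free v E r j ≡ free v′ E r j) where

    -- `w ^ w` is the exponential of w times the entropy of a uniform member of W. Splitting W by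
    -- the entry in the next row, `log-sum` bounds the entropy of that entry, and the fibres are
    -- left to the induction. Since all members agree on the revealed rows `E`, `free` offers each
    -- of them the same columns; after the last row they coincide, so W has at most one.
    chain-rule : ∀ {m} E (σ : Vec I m) W → Unique W →
      (∀ {v v′} → v ∈ W → v′ ∈ W → Agree E v v′) →
      (∀ {v} → v ∈ W → Valid v E σ) →
      (∀ {v v′} → Agree E v v′ → (∀ {r} → r ∈ toList σ → x v r ≡ x v′ r) → v ≡ v′) →
      length W ^ length W ≤ ∏ W (λ v → ∏ (allFin m) (choices v E σ))
    chain-rule E [] [] W! agree valid det = ≤-refl
    chain-rule E [] (_ ∷ []) W! agree valid det = ≤-refl
    chain-rule E [] (v ∷ v′ ∷ W) ((v≢v′ All.∷ _) ∷ _) agree valid det =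
      ⊥-elim (v≢v′ (det (agree (here refl) (there (here refl))) λ ()))
    chain-rule E (r ∷ σ) [] W! agree valid det = ≤-refl
    chain-rule {suc m} E (r ∷ σ) W@(v₀ ∷ _) W! agree valid det = begin
      length W ^ length W
        ≡⟨ cong (λ z → z ^ z) (∑-fibres x-r W) ⟨
      ∑ (allFin n) c ^ ∑ (allFin n) c
        ≤⟨ log-sum (allFin n) c (free v₀ E r) supp ⟩
      N ^ ∑ (allFin n) c * ∏ (allFin n) (λ j → c j ^ c j)
        ≤⟨ *-mono-≤ (≤-reflexive (cong (N ^_) (∑-fibres x-r W))) (∏-mono (allFin n) (λ {j} _ → ih j)) ⟩
      N ^ length W * ∏ (allFin n) (λ j → ∏ (fibre j) rest)
        ≡⟨ cong₂ _*_ (sym (∏-const W N)) (∏-fibres x-r W rest) ⟩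
      ∏ W (λ _ → N) * ∏ W rest
        ≡⟨ ∏-distrib-* W (λ _ → N) rest ⟨
      ∏ W (λ v → N * rest v)
        ≡⟨ ∏-cong W (λ {v} v∈W → trans (cong (_* rest v) (sym (N-const v∈W))) (sym (∏-allFin-suc m (choices v E (r ∷ σ))))) ⟩
      ∏ W (λ v → ∏ (allFin (suc m)) (choices v E (r ∷ σ))) ∎
      where
      open ≤-Reasoning
      x-r = λ v → x v r
      fibre : Fin n → List A
      fibre j = filter (λ v → x v r ≟ j) W
      c = λ j → length (fibre j)
      N = ∑ (allFin n) (𝟙 ∘ free v₀ E r)
      rest = λ v → ∏ (allFin m) (choices v (r ∷ E) σ)

      N-const : ∀ {v} → v ∈ W → ∑ (allFin n) (𝟙 ∘ free v E r) ≡ N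
      N-const v∈W = ∑-cong (allFin n) (λ {j} _ → cong 𝟙 (free-cong r j (agree v∈W (here refl))))

      fibre-∈ : ∀ {j v} → v ∈ fibre j → v ∈ W × x v r ≡ j
      fibre-∈ {j} = ∈-filter⁻ (λ v → x v r ≟ j) {xs = W}

      supp : ∀ j → free v₀ E r j ≡ false → c j ≡ 0
      supp j not-free with fibre j in eq
      ... | [] = refl
      ... | v ∷ _ with v∈W , refl ← fibre-∈ (subst (v ∈_) (sym eq) (here refl))
        with () ← trans (sym not-free) (trans (free-cong r (x v r) (agree (here refl) v∈W)) (proj₁ (valid v∈W)))

      ih : ∀ j → c j ^ c j ≤ ∏ (fibre j) rest
      ih j = chain-rule (r ∷ E) σ (fibre j) (filter⁺ (λ v → x v r ≟ j) W!)
        (λ v∈ v′∈ → λ where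
          (here refl) → trans (proj₂ (fibre-∈ v∈)) (sym (proj₂ (fibre-∈ v′∈)))
          (there r′∈E) → agree (proj₁ (fibre-∈ v∈)) (proj₁ (fibre-∈ v′∈)) r′∈E)
        (λ v∈ → proj₂ (valid (proj₁ (fibre-∈ v∈))))
        (λ onE onσ → det (onE ∘ there) λ where
          (here refl) → onE (here refl)
          (there r′∈σ) → onσ r′∈σ)

-- Random orders of the rows

𝟙-∧ : ∀ a b → 𝟙 (a ∧ b) ≡ 𝟙 a * 𝟙 b
𝟙-∧ true b = sym (+-identityʳ (𝟙 b))
𝟙-∧ false b = refl

-- The falling factorial x (x - 1) ... (x - k + 1). As `pred 0` is 0, it vanishes for k > x, as a
-- count of injections should.
falling : ℕ → ℕ → ℕ
falling x zero = 1
falling x (suc k) = x * falling (pred x) k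

∑-↭ : ∀ {xs ys : List A} f → xs ↭ ys → ∑ xs f ≡ ∑ ys f
∑-↭ f ↭.refl = refl
∑-↭ f (↭.prep x p) = cong (f x +_) (∑-↭ f p)
∑-↭ f (↭.swap {xs} x y p) = trans (eq (f x) (f y) (∑ xs f)) (cong (λ z → f y + (f x + z)) (∑-↭ f p))
  where
  eq : ∀ a b c → a + (b + c) ≡ b + (a + c)
  eq = solve-∀
∑-↭ f (↭.trans p q) = trans (∑-↭ f p) (∑-↭ f q)

picks : ∀ {m} → Vec A (suc m) → List (A × Vec A m)
picks {m = zero} (x ∷ []) = (x , []) ∷ []
picks {m = suc m} (x ∷ xs) = (x , xs) ∷ map (map₂ (x ∷_)) (picks xs)

orders : ∀ {m} → Vec A m → List (Vec A m)
orders {m = zero} xs = [] ∷ []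
orders {m = suc m} xs = concatMap (λ (y , ys) → map (y ∷_) (orders ys)) (picks xs)

picks-↭ : ∀ {m} {xs : Vec A (suc m)} {y ys} → (y , ys) ∈ picks xs → y ∷ toList ys ↭ toList xs
picks-↭ {m = zero} {x ∷ []} (here refl) = ↭.refl
picks-↭ {m = suc m} {x ∷ xs} (here refl) = ↭.refl
picks-↭ {m = suc m} {x ∷ xs} (there p) with (y , ys) , q , refl ← ∈-map⁻ (map₂ (x ∷_)) p =
  ↭.trans (↭.swap y x ↭.refl) (↭.prep x (picks-↭ q))

orders-↭ : ∀ {m} (xs : Vec A m) {σ} → σ ∈ orders xs → toList σ ↭ toList xs
orders-↭ [] (here refl) = ↭.refl
orders-↭ xs@(_ ∷ _) p
  with (y , ys) , q , p′ ← find (∈-concatMap⁻ (λ (y , ys) → map (y ∷_) (orders ys)) {xs = picks xs} p)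
  with σ , r , refl ← ∈-map⁻ (y ∷_) p′ = ↭.trans (↭.prep y (orders-↭ ys r)) (picks-↭ q)

∑-picks : ∀ {m} (xs : Vec A (suc m)) f → ∑ (picks xs) (f ∘ proj₁) ≡ ∑ (toList xs) f
∑-picks {m = zero} (x ∷ []) f = refl
∑-picks {m = suc m} (x ∷ xs) f = cong (f x +_) (trans (∑-map (map₂ (x ∷_)) (picks xs) (f ∘ proj₁)) (∑-picks xs f))

∑-orders : ∀ {m} (xs : Vec A (suc m)) f →
  ∑ (orders xs) f ≡ ∑ (picks xs) (λ (y , ys) → ∑ (orders ys) (λ σ → f (y ∷ σ)))
∑-orders xs f = trans (∑-concatMap _ (picks xs) f) (∑-cong (picks xs) (λ {(y , ys)} _ → ∑-map (y ∷_) (orders ys) f))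

length-∑ : ∀ (xs : List A) → ∑ xs (λ _ → 1) ≡ length xs
length-∑ xs = trans (∑-const xs 1) (*-identityʳ _)

length-toList : ∀ {m} (xs : Vec A m) → length (toList xs) ≡ m
length-toList [] = refl
length-toList (x ∷ xs) = cong suc (length-toList xs)

length-orders : ∀ {m} (xs : Vec A m) → length (orders xs) ≡ m !
length-orders {m = zero} xs = refl
length-orders {m = suc m} xs = begin
  length (orders xs)                                   ≡⟨ length-∑ (orders xs) ⟨
  ∑ (orders xs) (λ _ → 1)                              ≡⟨ ∑-orders xs _ ⟩
  ∑ (picks xs) (λ (y , ys) → ∑ (orders ys) (λ _ → 1))  ≡⟨ ∑-cong (picks xs) (λ {(y , ys)} _ → trans (length-∑ (orders ys)) (length-orders ys)) ⟩
  ∑ (picks xs) (λ _ → m !)                             ≡⟨ ∑-picks xs (λ _ → m !) ⟩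
  ∑ (toList xs) (λ _ → m !)                            ≡⟨ ∑-const (toList xs) _ ⟩
  length (toList xs) * m !                             ≡⟨ cong (_* m !) (length-toList xs) ⟩
  suc m * m !                                          ∎
  where open ≡-Reasoning

module Visits {I : Set} (a b : I → Bool) (disjoint : ∀ r → b r ≡ true → a r ≡ false) where

  -- Nonzero only if the order meets just rows with `b` before position k and a row with `a` at it;
  -- `a` will mark the row of a square, `b` the rows whose queens do not attack it.
  visits : ∀ {m} → Vec I m → Fin m → ℕ
  visits (r ∷ σ) zero = 𝟙 (a r)
  visits (r ∷ σ) (suc k) = 𝟙 (b r) * visits σ k

  -- The factors choose the row at position k, the k rows before it, and an arrangement of the
  -- remaining ones.
  ∑-visits : ∀ {m} (R : Vec I m) k →
    ∑ (orders R) (λ σ → visits σ k) ≡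
    ∑ (toList R) (𝟙 ∘ a) * falling (∑ (toList R) (𝟙 ∘ b)) (toℕ k) * (m ∸ suc (toℕ k)) !
  ∑-visits {suc m} R zero = begin
    ∑ (orders R) (λ σ → visits σ zero)                          ≡⟨ ∑-orders R _ ⟩
    ∑ (picks R) (λ (r , R′) → ∑ (orders R′) (λ _ → 𝟙 (a r)))    ≡⟨ ∑-cong (picks R) (λ {(r , R′)} _ → const r R′) ⟩
    ∑ (picks R) (λ (r , R′) → 𝟙 (a r) * m !)                    ≡⟨ ∑-*ʳ (picks R) (m !) _ ⟩
    ∑ (picks R) (𝟙 ∘ a ∘ proj₁) * m !                           ≡⟨ cong (_* m !) (∑-picks R (𝟙 ∘ a)) ⟩
    ∑ (toList R) (𝟙 ∘ a) * m !                                  ≡⟨ cong (_* m !) (*-identityʳ (∑ (toList R) (𝟙 ∘ a))) ⟨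
    ∑ (toList R) (𝟙 ∘ a) * 1 * m !                              ∎
    where
    open ≡-Reasoning
    const : ∀ r R′ → ∑ (orders R′) (λ _ → 𝟙 (a r)) ≡ 𝟙 (a r) * m !
    const r R′ = trans (∑-const (orders R′) _) (trans (cong (_* 𝟙 (a r)) (length-orders R′)) (*-comm (m !) _))
  ∑-visits {suc m} R (suc k) = begin
    ∑ (orders R) (λ σ → visits σ (suc k))                                   ≡⟨ ∑-orders R _ ⟩
    ∑ (picks R) (λ (r , R′) → ∑ (orders R′) (λ σ → 𝟙 (b r) * visits σ k))   ≡⟨ ∑-cong (picks R) (λ p → step p) ⟩
    ∑ (picks R) (λ (r , R′) → 𝟙 (b r) * (#a * fb * c))                      ≡⟨ ∑-*ʳ (picks R) (#a * fb * c) _ ⟩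
    ∑ (picks R) (𝟙 ∘ b ∘ proj₁) * (#a * fb * c)                             ≡⟨ cong (_* (#a * fb * c)) (∑-picks R (𝟙 ∘ b)) ⟩
    #b * (#a * fb * c)                                                      ≡⟨ eq #b #a fb c ⟩
    #a * (#b * fb) * c ∎
    where
    open ≡-Reasoning
    #a = ∑ (toList R) (𝟙 ∘ a)
    #b = ∑ (toList R) (𝟙 ∘ b)
    fb = falling (pred #b) (toℕ k)
    c = (m ∸ suc (toℕ k)) !
    eq : ∀ x y z w → x * (y * z * w) ≡ y * (x * z) * w
    eq = solve-∀
    step : ∀ {(r , R′) : I × Vec I m} → (r , R′) ∈ picks R →
      ∑ (orders R′) (λ σ → 𝟙 (b r) * visits σ k) ≡ 𝟙 (b r) * (#a * fb * c)
    step {r , R′} p = trans (∑-*ˡ (orders R′) (𝟙 (b r)) _) (trans (cong (𝟙 (b r) *_) (∑-visits R′ k)) (rem (b r) refl))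
      where
      rem : ∀ t → b r ≡ t → 𝟙 t * (∑ (toList R′) (𝟙 ∘ a) * falling (∑ (toList R′) (𝟙 ∘ b)) (toℕ k) * c) ≡ 𝟙 t * (#a * fb * c)
      rem false _ = refl
      -- Removing `r` keeps the count of `a`, by `disjoint`, and lowers that of `b` by one; this is
      -- the `pred` in `falling`.
      rem true br = cong (λ z → 1 * (z * c)) (cong₂ (λ u v → u * falling v (toℕ k))
        (trans (cong (λ t → 𝟙 t + ∑ (toList R′) (𝟙 ∘ a)) (sym (disjoint r br))) (∑-↭ (𝟙 ∘ a) (picks-↭ p)))
        (cong pred (trans (cong (λ t → 𝟙 t + ∑ (toList R′) (𝟙 ∘ b)) (sym br)) (∑-↭ (𝟙 ∘ b) (picks-↭ p)))))

does-≟-sym : ∀ {n} (i j : Fin n) → does (i ≟ j) ≡ does (j ≟ i)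
does-≟-sym i j with i ≟ j | j ≟ i
... | yes _ | yes _ = refl
... | no _ | no _ = refl
... | yes p | no ¬q = ⊥-elim (¬q (sym p))
... | no ¬p | yes q = ⊥-elim (¬p (sym q))

∑-select : ∀ {n} (i : Fin n) (f : Fin n → ℕ) → ∑ (allFin n) (λ j → f j * 𝟙 (does (i ≟ j))) ≡ f i
∑-select {n} i f = begin
  ∑ (allFin n) (λ j → f j * 𝟙 (does (i ≟ j)))   ≡⟨ ∑-cong (allFin n) (λ {j} _ → eq j) ⟩
  ∑ (allFin n) (λ j → f i * 𝟙 (does (i ≟ j)))   ≡⟨ ∑-*ˡ (allFin n) (f i) _ ⟩
  f i * ∑ (allFin n) (λ j → 𝟙 (does (i ≟ j)))   ≡⟨ cong (f i *_) (∑-indicator i) ⟩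
  f i * 1                                       ≡⟨ *-identityʳ (f i) ⟩
  f i                                           ∎
  where
  open ≡-Reasoning
  eq : ∀ j → f j * 𝟙 (does (i ≟ j)) ≡ f i * 𝟙 (does (i ≟ j))
  eq j with i ≟ j
  ... | yes refl = refl
  ... | no _ = trans (*-zeroʳ (f j)) (sym (*-zeroʳ (f i)))

-- Falling factorials

falling-suc : ∀ x k → falling x (suc k) ≡ falling x k * (x ∸ k)
falling-suc x zero = *-comm x 1
falling-suc zero (suc k) = refl
falling-suc (suc x) (suc k) = trans (cong (suc x *_) (falling-suc x k)) (sym (*-assoc (suc x) (falling x k) (x ∸ k)))

falling-zero : ∀ {x k} → x < k → falling x k ≡ 0
falling-zero {x} {suc k} x<1+k with m≤n⇒m<n∨m≡n (s≤s⁻¹ x<1+k)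
... | inj₁ x<k = trans (falling-suc x k) (cong (_* (x ∸ k)) (falling-zero x<k))
... | inj₂ refl = trans (falling-suc x x) (trans (cong (falling x x *_) (n∸n≡0 x)) (*-zeroʳ (falling x x)))

falling-mono : ∀ {x y} k → x ≤ y → falling x k ≤ falling y k
falling-mono zero x≤y = ≤-refl
falling-mono (suc k) x≤y = *-mono-≤ x≤y (falling-mono k (pred-mono-≤ x≤y))

falling-! : ∀ k l → falling (k + l) k * l ! ≡ (k + l) !
falling-! zero l = +-identityʳ (l !)
falling-! (suc k) l = trans (*-assoc (suc (k + l)) (falling (k + l) k) (l !)) (cong (suc (k + l) *_) (falling-! k l))

falling-pascal : ∀ x k → falling (suc x) (suc k) ≡ falling x (suc k) + suc k * falling x k
falling-pascal x k with k ≤? x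
... | no k≰x rewrite falling-suc x k | falling-zero (≰⇒> k≰x) = trans (*-zeroʳ (suc x)) (sym (*-zeroʳ (suc k)))
... | yes k≤x with e , refl ← m≤n⇒∃[o]m+o≡n k≤x = trans (eq k e F)
  (cong (_+ suc k * F) (sym (trans (falling-suc (k + e) k) (cong (F *_) (m+n∸m≡n k e)))))
  where
  F = falling (k + e) k
  eq : ∀ k e f → (1 + (k + e)) * f ≡ f * e + (1 + k) * f
  eq = solve-∀

-- By `falling-pascal` the first difference at x is a multiple of a falling factorial of x of lower
-- order, which grows with x.
falling-convex : ∀ x k → 2 * falling (suc x) k ≤ falling (2 + x) k + falling x k
falling-convex x zero = ≤-refl
falling-convex x (suc k) = begin
  2 * f₁                                            ≡⟨ cong (f₁ +_) (+-identityʳ f₁) ⟩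
  f₁ + f₁                                           ≡⟨ cong (f₁ +_) (falling-pascal x k) ⟩
  f₁ + (falling x (suc k) + suc k * falling x k)    ≤⟨ +-monoʳ-≤ f₁ (+-monoʳ-≤ (falling x (suc k)) (*-monoʳ-≤ (suc k) (falling-mono k (n≤1+n x)))) ⟩
  f₁ + (falling x (suc k) + suc k * falling (suc x) k) ≡⟨ eq f₁ (falling x (suc k)) _ ⟩
  f₁ + suc k * falling (suc x) k + falling x (suc k) ≡⟨ cong (_+ falling x (suc k)) (falling-pascal (suc x) k) ⟨
  falling (2 + x) (suc k) + falling x (suc k)       ∎
  where
  open ≤-Reasoning
  f₁ = falling (suc x) (suc k)
  eq : ∀ a b c → a + (b + c) ≡ a + c + b
  eq = solve-∀

*-∸-mono : ∀ {x n} k → x ≤ n → n * (x ∸ k) ≤ x * (n ∸ k)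
*-∸-mono {x} {n} k x≤n with k ≤? x
... | no k≰x rewrite m≤n⇒m∸n≡0 (<⇒≤ (≰⇒> k≰x)) | *-zeroʳ n = z≤n
... | yes k≤x with e , refl ← m≤n⇒∃[o]m+o≡n k≤x with f , refl ← m≤n⇒∃[o]m+o≡n x≤n
  rewrite m+n∸m≡n k e | +-assoc k e f | m+n∸m≡n k (e + f) =
  ≤-trans (m≤m+n _ (k * f)) (≤-reflexive (eq k e f))
  where
  eq : ∀ k e f → (k + (e + f)) * e + k * f ≡ (k + e) * (e + f)
  eq = solve-∀

-- The quotient of the two falling factorials is (x + 1 - k) / (x + 1), increasing in x. So each
-- further attacking queen costs a factor of at most (n - k) / n, whatever the number of safe rows:
-- the origin of the powers of l / n.
falling-ratio : ∀ {x n} k → x < n → n * falling x k ≤ falling (suc x) k * (n ∸ k)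
falling-ratio {x} {n} k x<n = *-cancelˡ-≤ (suc x) (begin
  suc x * (n * falling x k)               ≡⟨ eq (suc x) n (falling x k) ⟩
  n * falling (suc x) (suc k)             ≡⟨ cong (n *_) (falling-suc (suc x) k) ⟩
  n * (falling (suc x) k * (suc x ∸ k))   ≡⟨ eq n (falling (suc x) k) _ ⟩
  falling (suc x) k * (n * (suc x ∸ k))   ≤⟨ *-monoʳ-≤ (falling (suc x) k) (*-∸-mono k x<n) ⟩
  falling (suc x) k * (suc x * (n ∸ k))   ≡⟨ eq (falling (suc x) k) (suc x) _ ⟩
  suc x * (falling (suc x) k * (n ∸ k))   ∎)
  where
  open ≤-Reasoning
  eq : ∀ a b c → a * (b * c) ≡ b * (a * c)
  eq = solve-∀

-- As a function of d, `falling (2 + x - d) k` is convex and lies below its chord from d = 0 to d =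
-- 2. The chord is affine in d, so it can be summed over the squares when only the total of d is
-- known.
falling-chord : ∀ x g d k → d ≤ 2 → g + d ≤ 2 + x →
  2 * falling g k + d * falling (2 + x) k ≤ 2 * falling (2 + x) k + d * falling x k
falling-chord x g 0 k d≤2 le = +-monoˡ-≤ 0 (*-monoʳ-≤ 2 (falling-mono k (≤-trans (m≤m+n g 0) le)))
falling-chord x g 1 k d≤2 le = begin
  2 * falling g k + (F₀ + 0)     ≤⟨ +-monoˡ-≤ _ (*-monoʳ-≤ 2 (falling-mono k (s≤s⁻¹ (≤-trans (≤-reflexive (+-comm 1 g)) le)))) ⟩
  2 * falling (suc x) k + (F₀ + 0) ≤⟨ +-monoˡ-≤ _ (falling-convex x k) ⟩
  F₀ + falling x k + (F₀ + 0)    ≡⟨ eq F₀ (falling x k) ⟩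
  2 * F₀ + 1 * falling x k       ∎
  where
  open ≤-Reasoning
  F₀ = falling (2 + x) k
  eq : ∀ a b → a + b + (a + 0) ≡ 2 * a + 1 * b
  eq = solve-∀
falling-chord x g 2 k d≤2 le = ≤-trans
  (+-monoˡ-≤ (2 * falling (2 + x) k) (*-monoʳ-≤ 2 (falling-mono k (s≤s⁻¹ (s≤s⁻¹ (≤-trans (≤-reflexive (+-comm 2 g)) le))))))
  (≤-reflexive (+-comm (2 * falling x k) _))
falling-chord x g (suc (suc (suc _))) k (s≤s (s≤s ())) le

-- Diagonals of the board

term≤∑ : ∀ {xs : List A} {x} f → x ∈ xs → f x ≤ ∑ xs f
term≤∑ f (here refl) = m≤m+n _ _
term≤∑ f (there {y} p) = ≤-trans (term≤∑ f p) (m≤n+m _ (f y))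

length-allFin : ∀ n → length (allFin n) ≡ n
length-allFin n = length-tabulate id

∑-at-most-one : ∀ {n} (P : Fin n → Bool) → (∀ {r s} → P r ≡ true → P s ≡ true → r ≡ s) → ∑ (allFin n) (𝟙 ∘ P) ≤ 1
∑-at-most-one {zero} P uniq = z≤n
∑-at-most-one {suc n} P uniq rewrite ∑-allFin-suc n (𝟙 ∘ P) with P zero in p₀
... | false = ∑-at-most-one (P ∘ suc) (λ p q → Fin-suc-injective (uniq p q))
... | true = s≤s (≤-reflexive (trans (∑-cong (allFin n) (λ {r} _ → none r)) (trans (∑-const (allFin n) 0) (*-zeroʳ (length (allFin n))))))
  where
  none : ∀ r → 𝟙 (P (suc r)) ≡ 0
  none r with P (suc r) in p
  ... | false = refl
  ... | true with () ← uniq p₀ p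

∑-saturated : ∀ (xs : List A) f → (∀ x → f x ≤ 1) → ∑ xs f ≡ length xs → ∀ {x} → x ∈ xs → f x ≡ 1
∑-saturated (y ∷ xs) f f≤1 eq {x} x∈ = ≤-antisym (f≤1 x) (lower x∈)
  where
  tail≤ : ∀ zs → ∑ zs f ≤ length zs
  tail≤ zs = ≤-trans (∑-mono zs (λ {z} _ → f≤1 z)) (≤-reflexive (length-∑ zs))
  lower : x ∈ y ∷ xs → 1 ≤ f x
  lower (here refl) = +-cancelʳ-≤ (length xs) 1 (f y) (≤-trans (≤-reflexive (sym eq)) (+-monoʳ-≤ (f y) (tail≤ xs)))
  lower (there x∈xs) = ≤-reflexive (sym (∑-saturated xs f f≤1
    (≤-antisym (tail≤ xs) (s≤s⁻¹ (≤-trans (≤-reflexive (sym eq)) (+-monoˡ-≤ (∑ xs f) (f≤1 y))))) x∈xs))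

module _ {n} (c : Fin n → Fin n) (c-inj : ∀ {r s} → c r ≡ c s → r ≡ s) where

  -- Pigeonhole: every column has at most one preimage and there are n preimages in all, so each
  -- count is saturated.
  ∑-preimage : ∀ j → ∑ (allFin n) (λ r → 𝟙 (does (c r ≟ j))) ≡ 1
  ∑-preimage j = ∑-saturated (allFin n) (λ j → ∑ (allFin n) (λ r → 𝟙 (does (c r ≟ j))))
    (λ j → ∑-at-most-one _ (λ p q → c-inj (trans (does⇒≡ p) (sym (does⇒≡ q)))))
    (trans (∑-swap (allFin n) (allFin n) _) (trans (∑-cong (allFin n) (λ {r} _ → ∑-indicator (c r))) (length-∑ (allFin n))))
    (∈-allFin j)
    where
    does⇒≡ : ∀ {i j : Fin n} → does (i ≟ j) ≡ true → i ≡ j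
    does⇒≡ {i} {j} p with yes e ← i ≟ j = e

  ∑-injection : ∀ f → ∑ (allFin n) (f ∘ c) ≡ ∑ (allFin n) f
  ∑-injection f = begin
    ∑ (allFin n) (f ∘ c)                                                        ≡⟨ ∑-cong (allFin n) (λ {r} _ → ∑-select (c r) f) ⟨
    ∑ (allFin n) (λ r → ∑ (allFin n) (λ j → f j * 𝟙 (does (c r ≟ j))))          ≡⟨ ∑-swap (allFin n) (allFin n) _ ⟩
    ∑ (allFin n) (λ j → ∑ (allFin n) (λ r → f j * 𝟙 (does (c r ≟ j))))
      ≡⟨ ∑-cong (allFin n) (λ {j} _ → trans (∑-*ˡ (allFin n) (f j) _) (trans (cong (f j *_) (∑-preimage j)) (*-identityʳ (f j)))) ⟩
    ∑ (allFin n) f ∎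
    where open ≡-Reasoning

opposite-injective : ∀ {n} {i j : Fin n} → opposite i ≡ opposite j → i ≡ j
opposite-injective {i = i} {j} eq = trans (sym (opposite-involutive i)) (trans (cong opposite eq) (opposite-involutive j))

toℕ+opposite : ∀ {n} (i : Fin n) → suc (toℕ i + toℕ (opposite i)) ≡ n
toℕ+opposite i = trans (cong (λ z → suc (toℕ i) + z) (opposite-prop i)) (m+[n∸m]≡n (toℕ<n i))

T⇒true : ∀ {b} → T b → b ≡ true
T⇒true {true} _ = refl

true⇒T : ∀ {b} → b ≡ true → T b
true⇒T refl = _

≡⇒≡ᵇ-true : ∀ {x y} → x ≡ y → (x ≡ᵇ y) ≡ true
≡⇒≡ᵇ-true {x} {y} e = T⇒true (≡⇒≡ᵇ x y e)

≡ᵇ-true⇒≡ : ∀ {x y} → (x ≡ᵇ y) ≡ true → x ≡ y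
≡ᵇ-true⇒≡ {x} {y} p = ≡ᵇ⇒≡ x y (true⇒T p)

-- Deleting the first row and column keeps the diagonal j = i + d and loses only its square (0 , d).
-- With d added on the right, no truncated subtraction is needed.
diagonal-length : ∀ n d → n ≤ d + ∑ (allFin n) (λ i → ∑ (allFin n) (λ j → 𝟙 (toℕ j ≡ᵇ toℕ i + d)))
diagonal-length zero d = z≤n
diagonal-length (suc n) d with d <? suc n
... | no d≮ = ≤-trans (≮⇒≥ d≮) (m≤m+n d _)
... | yes d< = begin
  suc n                          ≤⟨ s≤s (diagonal-length n d) ⟩
  suc (d + ∑ (allFin n) row)     ≡⟨ +-suc d _ ⟨
  d + (1 + ∑ (allFin n) row)     ≤⟨ +-monoʳ-≤ d (+-mono-≤ head (∑-mono (allFin n) (λ {i} _ → tail i))) ⟩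
  d + (row′ zero + ∑ (allFin n) (row′ ∘ suc)) ≡⟨ cong (d +_) (∑-allFin-suc n row′) ⟨
  d + ∑ (allFin (suc n)) row′    ∎
  where
  open ≤-Reasoning
  row = λ i → ∑ (allFin n) (λ j → 𝟙 (toℕ j ≡ᵇ toℕ i + d))
  row′ : Fin (suc n) → ℕ
  row′ = λ i → ∑ (allFin (suc n)) (λ j → 𝟙 (toℕ j ≡ᵇ toℕ i + d))
  head : 1 ≤ row′ zero
  head = ≤-trans (≤-reflexive (sym (cong 𝟙 (≡⇒≡ᵇ-true (toℕ-fromℕ< d<)))))
    (term≤∑ (λ j → 𝟙 (toℕ j ≡ᵇ d)) (∈-allFin (fromℕ< d<)))
  tail : ∀ i → row i ≤ row′ (suc i)
  tail i = ≤-reflexive (sym (∑-allFin-suc n (λ j → 𝟙 (toℕ j ≡ᵇ suc (toℕ i + d)))))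

∣m+n-m∣≡n : ∀ m n → ∣ m + n - m ∣ ≡ n
∣m+n-m∣≡n m n = trans (∣-∣-comm (m + n) m) (∣m-m+n∣≡n m n)

diagonal-through : ∀ n r a → n ≤ ∣ r - a ∣ + ∑ (allFin n) (λ i → ∑ (allFin n) (λ j → 𝟙 (r + toℕ j ≡ᵇ toℕ i + a)))
diagonal-through n r a with ≤-total r a
... | inj₁ r≤a with d , refl ← m≤n⇒∃[o]m+o≡n r≤a = begin
  n         ≤⟨ diagonal-length n d ⟩
  d + ∑ (allFin n) (λ i → ∑ (allFin n) (λ j → 𝟙 (toℕ j ≡ᵇ toℕ i + d)))
    ≤⟨ +-mono-≤ (≤-reflexive (sym (∣m-m+n∣≡n r d))) (∑-mono (allFin n) (λ {i} _ → ∑-mono (allFin n) (λ {j} _ → le i j))) ⟩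
  ∣ r - (r + d) ∣ + ∑ (allFin n) (λ i → ∑ (allFin n) (λ j → 𝟙 (r + toℕ j ≡ᵇ toℕ i + (r + d)))) ∎
  where
  open ≤-Reasoning
  le : ∀ i j → 𝟙 (toℕ j ≡ᵇ toℕ i + d) ≤ 𝟙 (r + toℕ j ≡ᵇ toℕ i + (r + d))
  le i j with toℕ j ≡ᵇ toℕ i + d in p
  ... | false = z≤n
  ... | true = ≤-reflexive (sym (cong 𝟙 (≡⇒≡ᵇ-true (trans (cong (r +_) (≡ᵇ-true⇒≡ p)) (eq r (toℕ i) d)))))
    where
    eq : ∀ a b c → a + (b + c) ≡ b + (a + c)
    eq = solve-∀
... | inj₂ a≤r with d , refl ← m≤n⇒∃[o]m+o≡n a≤r = begin
  n         ≤⟨ diagonal-length n d ⟩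
  d + ∑ (allFin n) (λ j → ∑ (allFin n) (λ i → 𝟙 (toℕ i ≡ᵇ toℕ j + d)))  ≡⟨ cong (d +_) (∑-swap (allFin n) (allFin n) _) ⟩
  d + ∑ (allFin n) (λ i → ∑ (allFin n) (λ j → 𝟙 (toℕ i ≡ᵇ toℕ j + d)))
    ≤⟨ +-mono-≤ (≤-reflexive (sym (∣m+n-m∣≡n a d))) (∑-mono (allFin n) (λ {i} _ → ∑-mono (allFin n) (λ {j} _ → le i j))) ⟩
  ∣ (a + d) - a ∣ + ∑ (allFin n) (λ i → ∑ (allFin n) (λ j → 𝟙 ((a + d) + toℕ j ≡ᵇ toℕ i + a))) ∎
  where
  open ≤-Reasoning
  le : ∀ i j → 𝟙 (toℕ i ≡ᵇ toℕ j + d) ≤ 𝟙 ((a + d) + toℕ j ≡ᵇ toℕ i + a)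
  le i j with toℕ i ≡ᵇ toℕ j + d in p
  ... | false = z≤n
  ... | true = ≤-reflexive (sym (cong 𝟙 (≡⇒≡ᵇ-true (trans (eq a d (toℕ j)) (cong (_+ a) (sym (≡ᵇ-true⇒≡ p)))))))
    where
    eq : ∀ a b c → (a + b) + c ≡ (c + b) + a
    eq = solve-∀

-- weight n x x′ bounds 2 max(∣x - x′∣ , n / 2) when x and x′ = n - 1 - x are opposite.
weight : ℕ → ℕ → ℕ → ℕ
weight n x x′ = n + ((n ∸ 2 ∸ 4 * x) + (n ∸ 2 ∸ 4 * x′))

weight-comm : ∀ n x y → weight n x y ≡ weight n y x
weight-comm n x y = cong (n +_) (+-comm (n ∸ 2 ∸ 4 * x) _)

-- Since x + x′ = n - 1, twice the distance is n + (n - 2 - 4x). Where the bracket is negative,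
-- truncation leaves n, which is then the larger number.
∣x-x′∣≤weight-ordered : ∀ x x′ → x ≤ x′ → 2 * ∣ x - x′ ∣ ≤ weight (suc (x + x′)) x x′
∣x-x′∣≤weight-ordered x x′ x≤x′ with d , refl ← m≤n⇒∃[o]m+o≡n x≤x′ = begin
  2 * ∣ x - x + d ∣          ≡⟨ cong (2 *_) (∣m-m+n∣≡n x d) ⟩
  2 * d                      ≤⟨ +-cancelʳ-≤ (2 + 4 * x) _ _ (begin
    2 * d + (2 + 4 * x)      ≡⟨ eq x d ⟩
    n + n                    ≤⟨ +-monoʳ-≤ n (m≤n+m∸n n (2 + 4 * x)) ⟩
    n + (2 + 4 * x + (n ∸ (2 + 4 * x)))  ≡⟨ eq₂ n (2 + 4 * x) _ ⟩
    n + (n ∸ (2 + 4 * x)) + (2 + 4 * x)  ∎) ⟩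
  n + (n ∸ (2 + 4 * x))      ≡⟨ cong (n +_) (sym (∸-+-assoc n 2 (4 * x))) ⟩
  n + (n ∸ 2 ∸ 4 * x)        ≤⟨ +-monoʳ-≤ n (m≤m+n _ _) ⟩
  weight n x (x + d)         ∎
  where
  open ≤-Reasoning
  n = suc (x + (x + d))
  eq : ∀ x d → 2 * d + (2 + 4 * x) ≡ (1 + (x + (x + d))) + (1 + (x + (x + d)))
  eq = solve-∀
  eq₂ : ∀ a b c → a + (b + c) ≡ a + c + b
  eq₂ = solve-∀
∣x-x′∣≤weight : ∀ x x′ → 2 * ∣ x - x′ ∣ ≤ weight (suc (x + x′)) x x′
∣x-x′∣≤weight x x′ with ≤-total x x′
... | inj₁ x≤x′ = ∣x-x′∣≤weight-ordered x x′ x≤x′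
... | inj₂ x′≤x = subst₂ _≤_ (cong (2 *_) (∣-∣-comm x′ x))
  (trans (cong (λ n → weight (suc n) x′ x) (+-comm x′ x)) (weight-comm (suc (x + x′)) x′ x)) (∣x-x′∣≤weight-ordered x′ x x′≤x)

-- The pairs r , r′ and a , a′ have the same midpoint. If r lies between a and a′, the two distances
-- add up to that from a to a′; otherwise they add up to twice the distance from r to the midpoint,
-- that from r to r′.
reflected-distances : ∀ r r′ a a′ → r + r′ ≡ a + a′ →
  ∣ r - a ∣ + ∣ r - a′ ∣ ≤ ∣ a - a′ ∣ ⊎ ∣ r - a ∣ + ∣ r - a′ ∣ ≤ ∣ r - r′ ∣
reflected-distances r r′ a a′ eq with ≤-total r a | ≤-total r a′
... | inj₁ r≤a | inj₁ r≤a′ with d , refl ← m≤n⇒∃[o]m+o≡n r≤a | e , refl ← m≤n⇒∃[o]m+o≡n r≤a′ =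
  inj₂ (≤-reflexive (trans (cong₂ _+_ (∣m-m+n∣≡n r d) (∣m-m+n∣≡n r e))
    (sym (trans (cong (∣ r -_∣) (+-cancelˡ-≡ r r′ (r + (d + e)) (trans eq (arith r d e)))) (∣m-m+n∣≡n r (d + e))))))
  where
  arith : ∀ r d e → r + d + (r + e) ≡ r + (r + (d + e))
  arith = solve-∀
... | inj₁ r≤a | inj₂ a′≤r with d , refl ← m≤n⇒∃[o]m+o≡n r≤a | e , refl ← m≤n⇒∃[o]m+o≡n a′≤r =
  inj₁ (≤-reflexive (trans (cong₂ _+_ (∣m-m+n∣≡n (a′ + e) d) (∣m+n-m∣≡n a′ e))
    (sym (trans (cong (∣_- a′ ∣) (+-assoc a′ e d)) (trans (∣m+n-m∣≡n a′ (e + d)) (+-comm e d))))))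
... | inj₂ a≤r | inj₁ r≤a′ with d , refl ← m≤n⇒∃[o]m+o≡n a≤r | e , refl ← m≤n⇒∃[o]m+o≡n r≤a′ =
  inj₁ (≤-reflexive (trans (cong₂ _+_ (∣m+n-m∣≡n a d) (∣m-m+n∣≡n (a + d) e))
    (sym (trans (cong (∣ a -_∣) (+-assoc a d e)) (∣m-m+n∣≡n a (d + e))))))
... | inj₂ a≤r | inj₂ a′≤r with d , refl ← m≤n⇒∃[o]m+o≡n a≤r | e , eq′ ← m≤n⇒∃[o]m+o≡n a′≤r =
  inj₂ (≤-reflexive (trans (cong₂ _+_ (∣m+n-m∣≡n a d) (trans (cong (∣_- a′ ∣) (sym eq′)) (∣m+n-m∣≡n a′ e)))
    (sym (trans (cong (∣_- r′ ∣) (trans (sym eq′) (trans (cong (_+ e) (sym a′≡)) (+-assoc r′ d e)))) (∣m+n-m∣≡n r′ (d + e))))))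
  where
  a′≡ : r′ + d ≡ a′
  a′≡ = +-cancelˡ-≡ a (r′ + d) a′ (trans (arith a d r′) eq)
    where
    arith : ∀ a d r → a + (r + d) ≡ a + d + r
    arith = solve-∀

-- Trades a maximum for a row part plus a column part: the part that does not attain the maximum
-- still weighs at least n, and this pays for the n added on the left.
reflected-distances≤weight : ∀ r r′ a a′ → r + r′ ≡ a + a′ →
  2 * (∣ r - a ∣ + ∣ r - a′ ∣) + suc (r + r′) ≤ weight (suc (r + r′)) r r′ + weight (suc (r + r′)) a a′
reflected-distances≤weight r r′ a a′ eq with reflected-distances r r′ a a′ eq
... | inj₁ le rewrite eq = ≤-trans (≤-reflexive (+-comm _ (suc (a + a′))))
  (+-mono-≤ (m≤m+n (suc (a + a′)) _) (≤-trans (*-monoʳ-≤ 2 le) (∣x-x′∣≤weight a a′)))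
... | inj₂ le = +-mono-≤ (≤-trans (*-monoʳ-≤ 2 le) (∣x-x′∣≤weight r r′)) (m≤m+n _ _)

-- Passing from c to c - 4 lowers (c + 2)² by exactly 8c, eight times the first term; this dictates
-- the shift by 2. For c < 4 only the first term survives. At c = n - 2 the bound is n².
∑-triangle : ∀ n c → 8 * ∑ (allFin n) (λ x → c ∸ 4 * toℕ x) ≤ (c + 2) * (c + 2)
∑-triangle zero c = z≤n
∑-triangle (suc n) c = begin
  8 * ∑ (allFin (suc n)) (λ x → c ∸ 4 * toℕ x)
    ≡⟨ cong (8 *_) (trans (∑-allFin-suc n (λ x → c ∸ 4 * toℕ x)) (cong (c +_) (∑-cong (allFin n) (λ {x} _ → shift (toℕ x))))) ⟩
  8 * (c + ∑ (allFin n) (λ x → c ∸ 4 ∸ 4 * toℕ x))   ≤⟨ bound c ⟩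
  (c + 2) * (c + 2) ∎
  where
  open ≤-Reasoning
  shift : ∀ x → c ∸ 4 * suc x ≡ c ∸ 4 ∸ 4 * x
  shift x = trans (cong (c ∸_) (*-suc 4 x)) (sym (∸-+-assoc c 4 (4 * x)))
  vanish : ∀ c → 8 * c ≤ (c + 2) * (c + 2) → 8 * (c + ∑ (allFin n) (λ x → 0 ∸ 4 * toℕ x)) ≤ (c + 2) * (c + 2)
  vanish c le = ≤-trans (≤-reflexive (cong (8 *_) (trans (cong (c +_)
    (trans (∑-cong (allFin n) (λ {x} _ → 0∸n≡0 (4 * toℕ x))) (trans (∑-const (allFin n) 0) (*-zeroʳ (length (allFin n))))))
    (+-identityʳ c)))) le
  bound : ∀ c → 8 * (c + ∑ (allFin n) (λ x → c ∸ 4 ∸ 4 * toℕ x)) ≤ (c + 2) * (c + 2)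
  bound 0 = vanish 0 (≤ᵇ⇒≤ _ _ _)
  bound 1 = vanish 1 (≤ᵇ⇒≤ _ _ _)
  bound 2 = vanish 2 (≤ᵇ⇒≤ _ _ _)
  bound 3 = vanish 3 (≤ᵇ⇒≤ _ _ _)
  bound (suc (suc (suc (suc e)))) = begin
    8 * (4 + e + S)           ≡⟨ *-distribˡ-+ 8 (4 + e) S ⟩
    8 * (4 + e) + 8 * S       ≤⟨ +-monoʳ-≤ (8 * (4 + e)) (∑-triangle n e) ⟩
    8 * (4 + e) + (e + 2) * (e + 2) ≡⟨ eq e ⟩
    (4 + e + 2) * (4 + e + 2) ∎
    where
    S = ∑ (allFin n) (λ x → e ∸ 4 * toℕ x)
    eq : ∀ e → 8 * (4 + e) + (e + 2) * (e + 2) ≡ (4 + e + 2) * (4 + e + 2)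
    eq = solve-∀

∑-weight : ∀ n → 2 ≤ n → 4 * ∑ (allFin n) (λ i → weight n (toℕ i) (toℕ (opposite i))) ≤ 5 * (n * n)
∑-weight n 2≤n = begin
  4 * ∑ (allFin n) (λ i → weight n (toℕ i) (toℕ (opposite i)))
    ≡⟨ cong (4 *_) (trans (∑-distrib-+ (allFin n) _ _) (cong₂ _+_ (trans (∑-const (allFin n) n) (cong (_* n) (length-allFin n)))
      (trans (∑-distrib-+ (allFin n) _ _) (cong (S +_) (∑-injection {n} opposite opposite-injective (λ x → n ∸ 2 ∸ 4 * toℕ x)))))) ⟩
  4 * (n * n + (S + S))     ≡⟨ eq (n * n) S ⟩
  4 * (n * n) + 8 * S       ≤⟨ +-monoʳ-≤ (4 * (n * n)) (∑-triangle n (n ∸ 2)) ⟩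
  4 * (n * n) + (n ∸ 2 + 2) * (n ∸ 2 + 2) ≡⟨ cong (λ z → 4 * (n * n) + z * z) (m∸n+n≡m 2≤n) ⟩
  4 * (n * n) + n * n       ≡⟨ eq₂ (n * n) ⟩
  5 * (n * n) ∎
  where
  open ≤-Reasoning
  S = ∑ (allFin n) (λ x → n ∸ 2 ∸ 4 * toℕ x)
  eq : ∀ a b → 4 * (a + (b + b)) ≡ 4 * a + 8 * b
  eq = solve-∀
  eq₂ : ∀ a → 4 * a + a ≡ 5 * a
  eq₂ = solve-∀

-- Queens and the squares they attack

module Board {n} (c : Fin n → Fin n) where

  col : Fin n → Fin n → Bool
  diag anti : Fin n → Fin n → Fin n → Bool
  col r j = toℕ (c r) ≡ᵇ toℕ j
  diag r i j = toℕ r + toℕ j ≡ᵇ toℕ i + toℕ (c r)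
  anti r i j = toℕ r + toℕ (c r) ≡ᵇ toℕ i + toℕ j

  -- The queen of row i never counts as safe for a square of that row: the square stops being
  -- available once its own row is revealed.
  safe : Fin n → Fin n → Fin n → Bool
  safe r i j = not (does (i ≟ r)) ∧ nonAttacking (toℕ r , toℕ (c r)) (toℕ i , toℕ j)

  #safe #diag : Fin n → Fin n → ℕ
  #safe i j = ∑ (allFin n) (λ r → 𝟙 (safe r i j))
  #diag i j = ∑ (allFin n) (λ r → 𝟙 (diag r i j) + 𝟙 (anti r i j))

nor-𝟙 : ∀ x y z → (x ≡ true → y ≡ false) → (x ≡ true → z ≡ false) → (y ≡ true → z ≡ false) →
  𝟙 (not x ∧ not y ∧ not z) + (𝟙 x + (𝟙 y + 𝟙 z)) ≤ 1
nor-𝟙 false false false _ _ _ = ≤-refl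
nor-𝟙 false false true _ _ _ = ≤-refl
nor-𝟙 false true z _ _ yz rewrite yz refl = ≤-refl
nor-𝟙 true y z xy xz _ rewrite xy refl | xz refl = ≤-refl

nor-true : ∀ x y z → not x ∧ not y ∧ not z ≡ true → x ≡ false × y ≡ false × z ≡ false
nor-true false false false _ = refl , refl , refl

false≢true : ∀ {b} → b ≡ false → b ≡ true → ∀ {A : Set} → A
false≢true refl ()

≢⇒≡ᵇ-false : ∀ {x y} → x ≢ y → (x ≡ᵇ y) ≡ false
≢⇒≡ᵇ-false {x} {y} x≢y with x ≡ᵇ y in p
... | false = refl
... | true = ⊥-elim (x≢y (≡ᵇ-true⇒≡ p))

does-≟-toℕ : ∀ {n} (i j : Fin n) → does (i ≟ j) ≡ (toℕ i ≡ᵇ toℕ j)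
does-≟-toℕ zero zero = refl
does-≟-toℕ zero (suc j) = refl
does-≟-toℕ (suc i) zero = refl
does-≟-toℕ (suc i) (suc j) = does-≟-toℕ i j

module Solution {n} (c : Fin n → Fin n)
  (sol : ∀ {r s} → r ≢ s → nonAttacking (toℕ r , toℕ (c r)) (toℕ s , toℕ (c s)) ≡ true) where

  open Board c

  c-injective : ∀ {r s} → c r ≡ c s → r ≡ s
  c-injective {r} {s} e with r ≟ s
  ... | yes p = p
  ... | no r≢s = false≢true (proj₁ (nor-true (toℕ (c r) ≡ᵇ toℕ (c s)) (toℕ r + toℕ (c s) ≡ᵇ toℕ s + toℕ (c r)) _ (sol r≢s))) (≡⇒≡ᵇ-true (cong toℕ e))

  diag-injective : ∀ {r s} → toℕ r + toℕ (c s) ≡ toℕ s + toℕ (c r) → r ≡ s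
  diag-injective {r} {s} e with r ≟ s
  ... | yes p = p
  ... | no r≢s = false≢true (proj₁ (proj₂ (nor-true (toℕ (c r) ≡ᵇ toℕ (c s)) (toℕ r + toℕ (c s) ≡ᵇ toℕ s + toℕ (c r)) _ (sol r≢s)))) (≡⇒≡ᵇ-true e)

  anti-injective : ∀ {r s} → toℕ r + toℕ (c r) ≡ toℕ s + toℕ (c s) → r ≡ s
  anti-injective {r} {s} e with r ≟ s
  ... | yes p = p
  ... | no r≢s = false≢true
    (proj₂ (proj₂ (nor-true (toℕ (c r) ≡ᵇ toℕ (c s)) (toℕ r + toℕ (c s) ≡ᵇ toℕ s + toℕ (c r)) _ (sol r≢s)))) (≡⇒≡ᵇ-true e)

  diag-unique : ∀ {i j r s} → diag r i j ≡ true → diag s i j ≡ true → r ≡ s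
  diag-unique {i} {j} {r} {s} p q = diag-injective (+-cancelʳ-≡ (toℕ j + toℕ i) _ _ (begin
    toℕ r + toℕ (c s) + (toℕ j + toℕ i)   ≡⟨ eq (toℕ r) (toℕ (c s)) (toℕ j) (toℕ i) ⟩
    (toℕ r + toℕ j) + (toℕ i + toℕ (c s)) ≡⟨ cong₂ _+_ (≡ᵇ-true⇒≡ {toℕ r + toℕ j} p) (sym (≡ᵇ-true⇒≡ {toℕ s + toℕ j} q)) ⟩
    (toℕ i + toℕ (c r)) + (toℕ s + toℕ j) ≡⟨ eq₂ (toℕ i) (toℕ (c r)) (toℕ s) (toℕ j) ⟩
    toℕ s + toℕ (c r) + (toℕ j + toℕ i)   ∎))
    where
    open ≡-Reasoning
    eq : ∀ a b d e → a + b + (d + e) ≡ (a + d) + (e + b)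
    eq = solve-∀
    eq₂ : ∀ a b d e → (a + b) + (d + e) ≡ d + b + (e + a)
    eq₂ = solve-∀

  anti-unique : ∀ {i j r s} → anti r i j ≡ true → anti s i j ≡ true → r ≡ s
  anti-unique {r = r} {s} p q = anti-injective (trans (≡ᵇ-true⇒≡ {toℕ r + toℕ (c r)} p) (sym (≡ᵇ-true⇒≡ {toℕ s + toℕ (c s)} q)))

  #diag≤2 : ∀ i j → #diag i j ≤ 2
  #diag≤2 i j = ≤-trans (≤-reflexive (∑-distrib-+ (allFin n) _ _))
    (+-mono-≤ (∑-at-most-one (λ r → diag r i j) (diag-unique {i} {j})) (∑-at-most-one (λ r → anti r i j) (anti-unique {i} {j})))

  #safe<n : ∀ i j → suc (#safe i j) ≤ n
  #safe<n i j = begin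
    suc (#safe i j)                                               ≡⟨ cong (_+ #safe i j) (∑-indicator i) ⟨
    ∑ (allFin n) (λ r → 𝟙 (does (i ≟ r))) + #safe i j             ≡⟨ ∑-distrib-+ (allFin n) _ _ ⟨
    ∑ (allFin n) (λ r → 𝟙 (does (i ≟ r)) + 𝟙 (safe r i j))        ≤⟨ ∑-mono (allFin n) (λ {r} _ → le (does (i ≟ r)) _) ⟩
    ∑ (allFin n) (λ _ → 1)                                        ≡⟨ trans (length-∑ (allFin n)) (length-allFin n) ⟩
    n ∎
    where
    open ≤-Reasoning
    le : ∀ a b → 𝟙 a + 𝟙 (not a ∧ b) ≤ 1
    le true _ = ≤-refl
    le false true = ≤-refl
    le false false = z≤n

  lines-disjoint : ∀ {i j} → c i ≢ j → ∀ r →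
    𝟙 (does (i ≟ r)) + (𝟙 (safe r i j) + (𝟙 (col r j) + (𝟙 (diag r i j) + 𝟙 (anti r i j)))) ≤ 1
  lines-disjoint {i} {j} ci≢j r with i ≟ r
  ... | yes refl = ≤-reflexive (cong suc (cong₂ _+_ (cong 𝟙 (≢⇒≡ᵇ-false ci≢j-ℕ))
    (cong₂ _+_ (cong 𝟙 (≢⇒≡ᵇ-false (λ e → ci≢j-ℕ (sym (+-cancelˡ-≡ (toℕ i) _ _ e)))))
      (cong 𝟙 (≢⇒≡ᵇ-false (λ e → ci≢j-ℕ (+-cancelˡ-≡ (toℕ i) _ _ e)))))))
    where
    ci≢j-ℕ : toℕ (c i) ≢ toℕ j
    ci≢j-ℕ e = ci≢j (toℕ-injective e)
  ... | no i≢r = nor-𝟙 (col r j) (diag r i j) (anti r i j)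
    (λ p → ≢⇒≡ᵇ-false λ e → i≢r (toℕ-injective (sym (+-cancelʳ-≡ (toℕ (c r)) _ _ (trans (cong (toℕ r +_) (≡ᵇ-true⇒≡ p)) e)))))
    (λ p → ≢⇒≡ᵇ-false λ e → i≢r (toℕ-injective (sym (+-cancelʳ-≡ (toℕ j) _ _ (trans (cong (toℕ r +_) (sym (≡ᵇ-true⇒≡ p))) e)))))
    (λ p → ≢⇒≡ᵇ-false λ e → i≢r (toℕ-injective (sym (double (≡ᵇ-true⇒≡ p) e))))
    where
    -- Adding the equations of both diagonals of a square gives twice its row, so they meet in that
    -- row only.
    double : ∀ {a b d e} → a + d ≡ b + e → a + e ≡ b + d → a ≡ b
    double {a} {b} {d} {e} p q = *-cancelˡ-≡ a b 2 (+-cancelʳ-≡ (d + e) _ _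
      (trans (eq a d e) (trans (cong₂ _+_ p q) (eq′ b d e))))
      where
      eq : ∀ a d e → 2 * a + (d + e) ≡ (a + d) + (a + e)
      eq = solve-∀
      eq′ : ∀ b d e → (b + e) + (b + d) ≡ 2 * b + (d + e)
      eq′ = solve-∀

  -- The n queens comprise the one in row i, the one in column j, those on the diagonals and the
  -- safe ones. These classes are disjoint because the square is unoccupied: a queen on it would lie
  -- on all its lines.
  #safe-unoccupied : ∀ {i j} → c i ≢ j → #safe i j + #diag i j + 2 ≤ n
  #safe-unoccupied {i} {j} ci≢j = begin
    #safe i j + #diag i j + 2         ≡⟨ eq (#safe i j) (#diag i j) ⟩
    1 + (#safe i j + (1 + #diag i j))
      ≡⟨ cong₂ (λ u v → u + (#safe i j + (v + #diag i j))) (sym (∑-indicator i))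
           (trans (sym (∑-preimage c c-injective j)) (∑-cong (allFin n) (λ {r} _ → cong 𝟙 (does-≟-toℕ (c r) j)))) ⟩
    ∑ (allFin n) (λ r → 𝟙 (does (i ≟ r))) + (#safe i j + (∑ (allFin n) (λ r → 𝟙 (col r j)) + #diag i j))
      ≡⟨ cong (λ z → ∑ (allFin n) (λ r → 𝟙 (does (i ≟ r))) + (#safe i j + z)) (∑-distrib-+ (allFin n) _ _) ⟨
    ∑ (allFin n) (λ r → 𝟙 (does (i ≟ r))) + (#safe i j + ∑ (allFin n) (λ r → 𝟙 (col r j) + (𝟙 (diag r i j) + 𝟙 (anti r i j))))
      ≡⟨ cong (∑ (allFin n) (λ r → 𝟙 (does (i ≟ r))) +_) (∑-distrib-+ (allFin n) _ _) ⟨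
    ∑ (allFin n) (λ r → 𝟙 (does (i ≟ r))) + ∑ (allFin n) (λ r → 𝟙 (safe r i j) + (𝟙 (col r j) + (𝟙 (diag r i j) + 𝟙 (anti r i j))))
      ≡⟨ ∑-distrib-+ (allFin n) _ _ ⟨
    ∑ (allFin n) (λ r → 𝟙 (does (i ≟ r)) + (𝟙 (safe r i j) + (𝟙 (col r j) + (𝟙 (diag r i j) + 𝟙 (anti r i j)))))
      ≤⟨ ∑-mono (allFin n) (λ {r} _ → lines-disjoint ci≢j r) ⟩
    ∑ (allFin n) (λ _ → 1)            ≡⟨ trans (length-∑ (allFin n)) (length-allFin n) ⟩
    n ∎
    where
    open ≤-Reasoning
    eq : ∀ s d → s + d + 2 ≡ 1 + (s + (1 + d))
    eq = solve-∀

  -- With n = 4 + x, an unoccupied square on d occupied diagonals has at most 2 + x - d safe rows,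
  -- and `falling-chord` applies. An occupied square gets the crude bound of n - 1 safe rows,
  -- recorded in the last term.
  square-bound : ∀ x k → n ≡ 4 + x → ∀ i j →
    2 * falling (#safe i j) k + #diag i j * falling (2 + x) k ≤
    2 * falling (2 + x) k + #diag i j * falling x k + 2 * (falling (3 + x) k * 𝟙 (does (c i ≟ j)))
  square-bound x k n≡ i j with c i ≟ j
  ... | no ci≢j = ≤-trans (falling-chord x (#safe i j) (#diag i j) k (#diag≤2 i j)
    (+-cancelʳ-≤ 2 _ _ (≤-trans (#safe-unoccupied ci≢j) (≤-reflexive (trans n≡ (+-comm 2 (2 + x)))))))
    (m≤m+n _ _)
  ... | yes _ = begin
    2 * falling (#safe i j) k + #diag i j * F₀
      ≤⟨ +-mono-≤ (*-monoʳ-≤ 2 (falling-mono k (s≤s⁻¹ (≤-trans (#safe<n i j) (≤-reflexive n≡))))) (*-monoˡ-≤ F₀ (#diag≤2 i j)) ⟩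
    2 * falling (3 + x) k + 2 * F₀       ≡⟨ eq (falling (3 + x) k) F₀ ⟩
    2 * F₀ + 2 * (falling (3 + x) k * 1) ≤⟨ +-monoˡ-≤ _ (m≤m+n (2 * F₀) (#diag i j * falling x k)) ⟩
    2 * F₀ + #diag i j * falling x k + 2 * (falling (3 + x) k * 1) ∎
    where
    open ≤-Reasoning
    F₀ = falling (2 + x) k
    eq : ∀ a b → 2 * a + 2 * b ≡ 2 * b + 2 * (a * 1)
    eq = solve-∀

  ∑diag ∑anti : Fin n → ℕ
  ∑diag r = ∑ (allFin n) (λ i → ∑ (allFin n) (λ j → 𝟙 (diag r i j)))
  ∑anti r = ∑ (allFin n) (λ i → ∑ (allFin n) (λ j → 𝟙 (anti r i j)))

  ∑-#diag : ∑ (allFin n) (λ i → ∑ (allFin n) (#diag i)) ≡ ∑ (allFin n) (λ r → ∑diag r + ∑anti r)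
  ∑-#diag = begin
    ∑ (allFin n) (λ i → ∑ (allFin n) (#diag i))
      ≡⟨ ∑-cong (allFin n) (λ {i} _ → ∑-swap (allFin n) (allFin n) _) ⟩
    ∑ (allFin n) (λ i → ∑ (allFin n) (λ r → ∑ (allFin n) (λ j → 𝟙 (diag r i j) + 𝟙 (anti r i j))))
      ≡⟨ ∑-swap (allFin n) (allFin n) _ ⟩
    ∑ (allFin n) (λ r → ∑ (allFin n) (λ i → ∑ (allFin n) (λ j → 𝟙 (diag r i j) + 𝟙 (anti r i j))))
      ≡⟨ ∑-cong (allFin n) (λ {r} _ → trans (∑-cong (allFin n) (λ {i} _ → ∑-distrib-+ (allFin n) _ _)) (∑-distrib-+ (allFin n) _ _)) ⟩
    ∑ (allFin n) (λ r → ∑diag r + ∑anti r) ∎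
    where open ≡-Reasoning

  -- Reflecting the columns turns the antidiagonal through a queen into the diagonal through its
  -- mirror image, so that `diagonal-through` serves both directions.
  ∑anti-reflect : ∀ r → ∑ (allFin n) (λ i → ∑ (allFin n) (λ j → 𝟙 (toℕ r + toℕ j ≡ᵇ toℕ i + toℕ (opposite (c r))))) ≤ ∑anti r
  ∑anti-reflect r = ∑-mono (allFin n) λ {i} _ → begin
    ∑ (allFin n) (λ j → 𝟙 (toℕ r + toℕ j ≡ᵇ toℕ i + toℕ (opposite (c r))))  ≤⟨ ∑-mono (allFin n) (λ {j} _ → le i j) ⟩
    ∑ (allFin n) (λ j → 𝟙 (anti r i (opposite j)))                          ≡⟨ ∑-injection opposite opposite-injective (λ j → 𝟙 (anti r i j)) ⟩
    ∑ (allFin n) (λ j → 𝟙 (anti r i j))                                     ∎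
    where
    open ≤-Reasoning
    reflect : ∀ r i j j′ a a′ → r + j ≡ i + a′ → j + j′ ≡ a + a′ → r + a ≡ i + j′
    reflect r i j j′ a a′ p q = +-cancelʳ-≡ (j + a′) _ _ (trans (eq r a j a′) (trans (cong₂ _+_ p (sym q)) (eq₂ i a′ j j′)))
      where
      eq : ∀ r a j a′ → r + a + (j + a′) ≡ (r + j) + (a + a′)
      eq = solve-∀
      eq₂ : ∀ i a′ j j′ → (i + a′) + (j + j′) ≡ i + j′ + (j + a′)
      eq₂ = solve-∀
    le : ∀ i j → 𝟙 (toℕ r + toℕ j ≡ᵇ toℕ i + toℕ (opposite (c r))) ≤ 𝟙 (anti r i (opposite j))
    le i j with toℕ r + toℕ j ≡ᵇ toℕ i + toℕ (opposite (c r)) in p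
    ... | false = z≤n
    ... | true = ≤-reflexive (sym (cong 𝟙 (≡⇒≡ᵇ-true (reflect (toℕ r) (toℕ i) (toℕ j) (toℕ (opposite j)) (toℕ (c r)) (toℕ (opposite (c r)))
      (≡ᵇ-true⇒≡ {toℕ r + toℕ j} p) (suc-injective (trans (toℕ+opposite j) (sym (toℕ+opposite (c r)))))))))

  weightᶠ : Fin n → ℕ
  weightᶠ i = weight n (toℕ i) (toℕ (opposite i))

  -- The amounts p and q by which the two diagonals fall short of n are absorbed by the weights. The
  -- weights keep row and column apart, so each can be summed over the whole board.
  queen-diagonals : ∀ r → 5 * n ≤ 2 * (∑diag r + ∑anti r) + (weightᶠ r + weightᶠ (c r))
  queen-diagonals r = combine ∣ toℕ r - toℕ (c r) ∣ ∣ toℕ r - toℕ (opposite (c r)) ∣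
    (diagonal-through n (toℕ r) (toℕ (c r)))
    (≤-trans (diagonal-through n (toℕ r) (toℕ (opposite (c r)))) (+-monoʳ-≤ _ (∑anti-reflect r)))
    (subst (λ m → 2 * (∣ toℕ r - toℕ (c r) ∣ + ∣ toℕ r - toℕ (opposite (c r)) ∣) + m ≤
        weight m (toℕ r) (toℕ (opposite r)) + weight m (toℕ (c r)) (toℕ (opposite (c r))))
      (toℕ+opposite r)
      (reflected-distances≤weight (toℕ r) (toℕ (opposite r)) (toℕ (c r)) (toℕ (opposite (c r)))
        (suc-injective (trans (toℕ+opposite r) (sym (toℕ+opposite (c r)))))))
    where
    combine : ∀ {n L L′ w} p q → n ≤ p + L → n ≤ q + L′ → 2 * (p + q) + n ≤ w → 5 * n ≤ 2 * (L + L′) + w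
    combine {n} {L} {L′} {w} p q l₁ l₂ l₃ = +-cancelʳ-≤ (2 * (p + q)) _ _ (begin
      5 * n + 2 * (p + q)                              ≡⟨ eq n (p + q) ⟩
      2 * (n + n) + (2 * (p + q) + n)                  ≤⟨ +-mono-≤ (*-monoʳ-≤ 2 (+-mono-≤ l₁ l₂)) l₃ ⟩
      2 * (p + L + (q + L′)) + w                       ≡⟨ eq₂ p q L L′ w ⟩
      2 * (L + L′) + w + 2 * (p + q)                   ∎)
      where
      open ≤-Reasoning
      eq : ∀ n s → 5 * n + 2 * s ≡ 2 * (n + n) + (2 * s + n)
      eq = solve-∀
      eq₂ : ∀ p q L L′ w → 2 * (p + L + (q + L′)) + w ≡ 2 * (L + L′) + w + 2 * (p + q)
      eq₂ = solve-∀

  5n²≤4∑diag : 2 ≤ n → 5 * (n * n) ≤ 4 * ∑ (allFin n) (λ i → ∑ (allFin n) (#diag i))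
  5n²≤4∑diag 2≤n = *-cancelˡ-≤ 2 (+-cancelʳ-≤ (2 * (5 * (n * n))) _ _ (begin
    2 * (5 * (n * n)) + 2 * (5 * (n * n))       ≡⟨ eq n ⟩
    4 * (n * (5 * n))                           ≡⟨ cong (4 *_) (trans (cong (_* (5 * n)) (sym (length-allFin n))) (sym (∑-const (allFin n) (5 * n)))) ⟩
    4 * ∑ (allFin n) (λ _ → 5 * n)              ≤⟨ *-monoʳ-≤ 4 (∑-mono (allFin n) (λ {r} _ → queen-diagonals r)) ⟩
    4 * ∑ (allFin n) (λ r → 2 * (∑diag r + ∑anti r) + (weightᶠ r + weightᶠ (c r)))
      ≡⟨ cong (4 *_) (trans (∑-distrib-+ (allFin n) _ _) (cong₂ _+_ (∑-*ˡ (allFin n) 2 _)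
           (trans (∑-distrib-+ (allFin n) _ _) (cong (W +_) (∑-injection c c-injective weightᶠ))))) ⟩
    4 * (2 * ∑ (allFin n) (λ r → ∑diag r + ∑anti r) + (W + W))
      ≡⟨ cong (λ z → 4 * (2 * z + (W + W))) ∑-#diag ⟨
    4 * (2 * D + (W + W))                       ≡⟨ eq₂ D W ⟩
    2 * (4 * D) + 2 * (4 * W)                   ≤⟨ +-monoʳ-≤ (2 * (4 * D)) (*-monoʳ-≤ 2 (∑-weight n 2≤n)) ⟩
    2 * (4 * D) + 2 * (5 * (n * n))             ∎))
    where
    open ≤-Reasoning
    W = ∑ (allFin n) weightᶠ
    D = ∑ (allFin n) (λ i → ∑ (allFin n) (#diag i))
    eq : ∀ n → 2 * (5 * (n * n)) + 2 * (5 * (n * n)) ≡ 4 * (n * (5 * n))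
    eq = solve-∀
    eq₂ : ∀ D W → 4 * (2 * D + (W + W)) ≡ 2 * (4 * D) + 2 * (4 * W)
    eq₂ = solve-∀

-- The average number of free squares

∑∑ : ∀ {n} → (Fin n → Fin n → ℕ) → ℕ
∑∑ {n} f = ∑ (allFin n) (λ i → ∑ (allFin n) (f i))

∑∑-mono : ∀ {n} {f g : Fin n → Fin n → ℕ} → (∀ i j → f i j ≤ g i j) → ∑∑ f ≤ ∑∑ g
∑∑-mono {n} le = ∑-mono (allFin n) (λ {i} _ → ∑-mono (allFin n) (λ {j} _ → le i j))

∑∑-cong : ∀ {n} {f g : Fin n → Fin n → ℕ} → (∀ i j → f i j ≡ g i j) → ∑∑ f ≡ ∑∑ g
∑∑-cong {n} eq = ∑-cong (allFin n) (λ {i} _ → ∑-cong (allFin n) (λ {j} _ → eq i j))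

∑∑-distrib-+ : ∀ {n} (f g : Fin n → Fin n → ℕ) → ∑∑ (λ i j → f i j + g i j) ≡ ∑∑ f + ∑∑ g
∑∑-distrib-+ {n} f g = trans (∑-cong (allFin n) (λ {i} _ → ∑-distrib-+ (allFin n) (f i) (g i))) (∑-distrib-+ (allFin n) _ _)

∑∑-*ˡ : ∀ {n} a (f : Fin n → Fin n → ℕ) → ∑∑ (λ i j → a * f i j) ≡ a * ∑∑ f
∑∑-*ˡ {n} a f = trans (∑-cong (allFin n) (λ {i} _ → ∑-*ˡ (allFin n) a (f i))) (∑-*ˡ (allFin n) a _)

∑∑-*ʳ : ∀ {n} a (f : Fin n → Fin n → ℕ) → ∑∑ (λ i j → f i j * a) ≡ ∑∑ f * a
∑∑-*ʳ {n} a f = trans (∑-cong (allFin n) (λ {i} _ → ∑-*ʳ (allFin n) a (f i))) (∑-*ʳ (allFin n) a _)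

∑∑-const : ∀ n a → ∑∑ {n} (λ _ _ → a) ≡ n * (n * a)
∑∑-const n a = trans (∑-cong (allFin n) (λ _ → inner)) (trans (∑-const (allFin n) (n * a)) (cong (_* (n * a)) (length-allFin n)))
  where
  inner : ∑ (allFin n) (λ _ → a) ≡ n * a
  inner = trans (∑-const (allFin n) a) (cong (_* a) (length-allFin n))

-- In the summed chord bound D has the coefficient F₄ - F₂ ≤ 0, so a lower bound for D may replace
-- it. The excess `δ` of 4D over 5n² is carried on both sides instead of subtracting.
eliminate-diagonals : ∀ n G D F₁ F₂ F₄ → F₄ ≤ F₂ → 5 * (n * n) ≤ 4 * D →
  2 * G + D * F₂ ≤ n * (n * (2 * F₂)) + D * F₄ + 2 * (F₁ * n) →
  8 * G ≤ 3 * (n * n) * F₂ + 5 * (n * n) * F₄ + 8 * (n * F₁)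
eliminate-diagonals n G D F₁ F₂ F₄ F₄≤F₂ 5n²≤4D bound =
  let δ , 4D≡ = m≤n⇒∃[o]m+o≡n 5n²≤4D in
  +-cancelʳ-≤ (5 * (n * n) * F₂ + δ * F₂) _ _ (begin
  8 * G + (5 * (n * n) * F₂ + δ * F₂)        ≡⟨ cong (8 * G +_) (*-distribʳ-+ F₂ (5 * (n * n)) δ) ⟨
  8 * G + (5 * (n * n) + δ) * F₂             ≡⟨ cong (λ z → 8 * G + z * F₂) 4D≡ ⟩
  8 * G + 4 * D * F₂                         ≡⟨ eq G D F₂ ⟩
  4 * (2 * G + D * F₂)                       ≤⟨ *-monoʳ-≤ 4 bound ⟩
  4 * (n * (n * (2 * F₂)) + D * F₄ + 2 * (F₁ * n)) ≡⟨ eq₂ n D F₁ F₂ F₄ ⟩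
  8 * (n * n) * F₂ + 4 * D * F₄ + 8 * (n * F₁)     ≡⟨ cong (λ z → 8 * (n * n) * F₂ + z * F₄ + 8 * (n * F₁)) 4D≡ ⟨
  8 * (n * n) * F₂ + (5 * (n * n) + δ) * F₄ + 8 * (n * F₁)
    ≡⟨ cong (λ z → 8 * (n * n) * F₂ + z + 8 * (n * F₁)) (*-distribʳ-+ F₄ (5 * (n * n)) δ) ⟩
  8 * (n * n) * F₂ + (5 * (n * n) * F₄ + δ * F₄) + 8 * (n * F₁)
    ≤⟨ +-monoˡ-≤ (8 * (n * F₁)) (+-monoʳ-≤ (8 * (n * n) * F₂) (+-monoʳ-≤ (5 * (n * n) * F₄)
         (*-monoʳ-≤ δ F₄≤F₂))) ⟩
  8 * (n * n) * F₂ + (5 * (n * n) * F₄ + δ * F₂) + 8 * (n * F₁) ≡⟨ eq₃ (n * n) (δ * F₂) (n * F₁) F₂ F₄ ⟩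
  3 * (n * n) * F₂ + 5 * (n * n) * F₄ + 8 * (n * F₁) + (5 * (n * n) * F₂ + δ * F₂) ∎)
  where
  open ≤-Reasoning
  eq : ∀ g d f → 8 * g + 4 * d * f ≡ 4 * (2 * g + d * f)
  eq = solve-∀
  eq₂ : ∀ n d f₁ f₂ f₄ → 4 * (n * (n * (2 * f₂)) + d * f₄ + 2 * (f₁ * n)) ≡ 8 * (n * n) * f₂ + 4 * d * f₄ + 8 * (n * f₁)
  eq₂ = solve-∀
  eq₃ : ∀ m e q f₂ f₄ → 8 * m * f₂ + (5 * m * f₄ + e) + 8 * q ≡ 3 * m * f₂ + 5 * m * f₄ + 8 * q + (5 * m * f₂ + e)
  eq₃ = solve-∀

-- (l + 3)(3n² + 5l²) / 8n² bounds the mean number of free squares in the next row when l rows are left.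
level : ℕ → ℕ → ℕ
level n l = (l + 3) * (3 * (n * n) + 5 * (l * l))

module Levels {n} (c : Fin n → Fin n)
  (sol : ∀ {r s} → r ≢ s → nonAttacking (toℕ r , toℕ (c r)) (toℕ s , toℕ (c s)) ≡ true) where

  open Board c
  open Solution c sol

  module _ (x : ℕ) (n≡ : n ≡ 4 + x) (k : ℕ) where

    private
      G = ∑∑ (λ i j → falling (#safe i j) k)
      D = ∑∑ #diag
      F₂ = falling (2 + x) k
      F₄ = falling x k
      F₁ = falling (3 + x) k

    ∑∑-square-bound : 2 * G + D * F₂ ≤ n * (n * (2 * F₂)) + D * F₄ + 2 * (F₁ * n)
    ∑∑-square-bound = begin
      2 * G + D * F₂
        ≡⟨ cong₂ _+_ (∑∑-*ˡ 2 (λ i j → falling (#safe i j) k)) (∑∑-*ʳ F₂ #diag) ⟨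
      ∑∑ (λ i j → 2 * falling (#safe i j) k) + ∑∑ (λ i j → #diag i j * F₂)
        ≡⟨ ∑∑-distrib-+ (λ i j → 2 * falling (#safe i j) k) (λ i j → #diag i j * F₂) ⟨
      ∑∑ (λ i j → 2 * falling (#safe i j) k + #diag i j * F₂)
        ≤⟨ ∑∑-mono (square-bound x k n≡) ⟩
      ∑∑ (λ i j → 2 * F₂ + #diag i j * F₄ + 2 * (F₁ * 𝟙 (does (c i ≟ j))))
        ≡⟨ ∑∑-distrib-+ (λ i j → 2 * F₂ + #diag i j * F₄) (λ i j → 2 * (F₁ * 𝟙 (does (c i ≟ j)))) ⟩
      ∑∑ (λ i j → 2 * F₂ + #diag i j * F₄) + ∑∑ (λ i j → 2 * (F₁ * 𝟙 (does (c i ≟ j))))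
        ≡⟨ cong₂ _+_ (trans (∑∑-distrib-+ {n} (λ i j → 2 * F₂) (λ i j → #diag i j * F₄)) (cong₂ _+_ (∑∑-const n (2 * F₂)) (∑∑-*ʳ F₄ #diag)))
             (trans (∑∑-*ˡ 2 (λ i j → F₁ * 𝟙 (does (c i ≟ j)))) (cong (2 *_) (trans (∑∑-*ˡ F₁ (λ i j → 𝟙 (does (c i ≟ j)))) (cong (F₁ *_) queens)))) ⟩
      n * (n * (2 * F₂)) + D * F₄ + 2 * (F₁ * n) ∎
      where
      open ≤-Reasoning
      queens : ∑∑ (λ i j → 𝟙 (does (c i ≟ j))) ≡ n
      queens = trans (∑-cong (allFin n) (λ {i} _ → ∑-indicator (c i))) (trans (length-∑ (allFin n)) (length-allFin n))

    total-bound : 8 * G ≤ 3 * (n * n) * F₂ + 5 * (n * n) * F₄ + 8 * (n * F₁)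
    total-bound = eliminate-diagonals n G D F₁ F₂ F₄ (falling-mono k (m≤n+m x 2))
      (5n²≤4∑diag (≤-trans (m≤m+n 2 (2 + x)) (≤-reflexive (sym n≡)))) ∑∑-square-bound

    module _ (l : ℕ) (n≡k+l : n ≡ k + l) where

      private
        F₀ = falling n k

        ratio : ∀ y → y < n → n * falling y k ≤ falling (suc y) k * l
        ratio y y<n = ≤-trans (falling-ratio k y<n) (≤-reflexive (cong (falling (suc y) k *_) (trans (cong (_∸ k) n≡k+l) (m+n∸m≡n k l))))

        chain : ∀ y a {b} → y < n → a * falling (suc y) k ≤ b → (a * n) * falling y k ≤ b * l
        chain y a {b} y<n le = begin
          a * n * falling y k          ≡⟨ *-assoc a n _ ⟩
          a * (n * falling y k)        ≤⟨ *-monoʳ-≤ a (ratio y y<n) ⟩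
          a * (falling (suc y) k * l)  ≡⟨ *-assoc a _ l ⟨
          a * falling (suc y) k * l    ≤⟨ *-monoˡ-≤ l le ⟩
          b * l                        ∎
          where open ≤-Reasoning

        x<n : ∀ m → m < 4 → m + x < n
        x<n m m<4 = ≤-trans (+-monoˡ-≤ x m<4) (≤-reflexive (sym n≡))

        r₁ : 1 * n * F₁ ≤ F₀ * l
        r₁ = chain (3 + x) 1 (x<n 3 ≤-refl) (≤-reflexive (trans (+-identityʳ (falling (4 + x) k)) (cong (λ z → falling z k) (sym n≡))))
        r₂ : 1 * n * n * F₂ ≤ F₀ * l * l
        r₂ = chain (2 + x) (1 * n) (x<n 2 (≤ᵇ⇒≤ _ _ _)) r₁
        r₄ : 1 * n * n * n * n * F₄ ≤ F₀ * l * l * l * l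
        r₄ = chain x (1 * n * n * n) (x<n 0 (≤ᵇ⇒≤ _ _ _)) (chain (1 + x) (1 * n * n) (x<n 1 (≤ᵇ⇒≤ _ _ _)) r₂)

      level-bound : 8 * (n * n) * G ≤ F₀ * l * level n l
      level-bound = begin
        8 * (n * n) * G                 ≡⟨ eq (n * n) G ⟩
        (n * n) * (8 * G)               ≤⟨ *-monoʳ-≤ (n * n) total-bound ⟩
        (n * n) * (3 * (n * n) * F₂ + 5 * (n * n) * F₄ + 8 * (n * F₁))   ≡⟨ eq₂ n F₁ F₂ F₄ ⟩
        3 * (n * n) * (1 * n * n * F₂) + 5 * (1 * n * n * n * n * F₄) + 8 * (n * n) * (1 * n * F₁)
          ≤⟨ +-mono-≤ (+-mono-≤ (*-monoʳ-≤ (3 * (n * n)) r₂) (*-monoʳ-≤ 5 r₄)) (*-monoʳ-≤ (8 * (n * n)) r₁) ⟩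
        3 * (n * n) * (F₀ * l * l) + 5 * (F₀ * l * l * l * l) + 8 * (n * n) * (F₀ * l)
          -- The queen squares contribute 8n² times `F₀ * l`. Rounding this up to 9n² + 15l² makes
          -- `l + 3` a factor, which can later be split off from the quadratic one.
          ≤⟨ m≤m+n _ (F₀ * l * (n * n) + 15 * (F₀ * l * l * l)) ⟩
        3 * (n * n) * (F₀ * l * l) + 5 * (F₀ * l * l * l * l) + 8 * (n * n) * (F₀ * l) + (F₀ * l * (n * n) + 15 * (F₀ * l * l * l))
          ≡⟨ eq₃ n l F₀ ⟩
        F₀ * l * ((l + 3) * (3 * (n * n) + 5 * (l * l))) ∎
        where
        open ≤-Reasoning
        eq : ∀ m g → 8 * m * g ≡ m * (8 * g)
        eq = solve-∀
        eq₂ : ∀ n f₁ f₂ f₄ → (n * n) * (3 * (n * n) * f₂ + 5 * (n * n) * f₄ + 8 * (n * f₁)) ≡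
          3 * (n * n) * (1 * n * n * f₂) + 5 * (1 * n * n * n * n * f₄) + 8 * (n * n) * (1 * n * f₁)
        eq₂ = solve-∀
        eq₃ : ∀ n l f → 3 * (n * n) * (f * l * l) + 5 * (f * l * l * l * l) + 8 * (n * n) * (f * l) + (f * l * (n * n) + 15 * (f * l * l * l)) ≡
          f * l * ((l + 3) * (3 * (n * n) + 5 * (l * l)))
        eq₃ = solve-∀

  level-average : 4 ≤ n → ∀ (k : Fin n) →
    8 * (n * n) * ∑∑ (λ i j → falling (#safe i j) (toℕ k) * (n ∸ suc (toℕ k)) !) ≤ n ! * level n (n ∸ toℕ k)
  level-average 4≤n k with x , 4+x≡n ← m≤n⇒∃[o]m+o≡n 4≤n | o , k+o≡n ← m≤n⇒∃[o]m+o≡n (toℕ<n k) = begin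
    8 * (n * n) * ∑∑ (λ i j → falling (#safe i j) (toℕ k) * (n ∸ suc (toℕ k)) !)
      ≡⟨ cong (8 * (n * n) *_) (trans (∑∑-*ʳ ((n ∸ suc (toℕ k)) !) (λ i j → falling (#safe i j) (toℕ k))) (cong (λ z → G * z !) o≡)) ⟩
    8 * (n * n) * (G * o !)               ≡⟨ *-assoc (8 * (n * n)) G (o !) ⟨
    8 * (n * n) * G * o !                 ≤⟨ *-monoˡ-≤ (o !) (level-bound x (sym 4+x≡n) (toℕ k) (suc o) n≡) ⟩
    falling n (toℕ k) * suc o * level n (suc o) * o !   ≡⟨ eq (falling n (toℕ k)) (suc o) (level n (suc o)) (o !) ⟩
    falling n (toℕ k) * (suc o) ! * level n (suc o)
      ≡⟨ cong₂ (λ u v → u * level n v) (trans (cong (λ m → falling m (toℕ k) * (suc o) !) n≡) (trans (falling-! (toℕ k) (suc o)) (cong _! (sym n≡)))) l≡ ⟩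
    n ! * level n (n ∸ toℕ k)             ∎
    where
    open ≤-Reasoning
    G = ∑∑ (λ i j → falling (#safe i j) (toℕ k))
    n≡ : n ≡ toℕ k + suc o
    n≡ = trans (sym k+o≡n) (sym (+-suc (toℕ k) o))
    o≡ : n ∸ suc (toℕ k) ≡ o
    o≡ = trans (cong (_∸ suc (toℕ k)) (sym k+o≡n)) (m+n∸m≡n (suc (toℕ k)) o)
    l≡ : suc o ≡ n ∸ toℕ k
    l≡ = sym (trans (cong (_∸ toℕ k) n≡) (m+n∸m≡n (toℕ k) (suc o)))
    eq : ∀ f s v w → f * s * v * w ≡ f * (s * w) * v
    eq = solve-∀

-- The entropy bound for sets of solutions

toList-tabulate : ∀ {A : Set} {n} (f : Fin n → A) → toList (Vec.tabulate f) ≡ tabulate f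
toList-tabulate {n = zero} f = refl
toList-tabulate {n = suc n} f = cong (f zero ∷_) (toList-tabulate (f ∘ suc))

module Free {n : ℕ} where

  free : Vec (Fin n) n → List (Fin n) → Fin n → Fin n → Bool
  free v [] i j = true
  free v (r ∷ E) i j = Board.safe (lookup v) r i j ∧ free v E i j

  open Entropy (lookup {A = Fin n} {n = n}) free public

  free-cong : ∀ {v v′ E} i j → Agree E v v′ → free v E i j ≡ free v′ E i j
  free-cong {E = []} i j agree = refl
  free-cong {E = r ∷ E} i j agree = cong₂ _∧_
    (cong (λ a → not (does (i ≟ r)) ∧ nonAttacking (toℕ r , toℕ a) (toℕ i , toℕ j)) (agree (here refl)))
    (free-cong i j (agree ∘ there))

  module _ (i j : Fin n) (v : Vec (Fin n) n) where

    own-row-unsafe : ∀ r → Board.safe (lookup v) r i j ≡ true → does (i ≟ r) ≡ false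
    own-row-unsafe r p with does (i ≟ r)
    ... | false = refl

    open Visits (λ r → does (i ≟ r)) (λ r → Board.safe (lookup v) r i j) own-row-unsafe public

  -- The right-hand sum runs over all squares of the board, whatever row σ has at position k. Only
  -- in this form can it be exchanged with the sum over the orders.
  choices-visits : ∀ {m} v E (σ : Vec (Fin n) m) k →
    choices v E σ k ≡ ∑∑ (λ i j → 𝟙 (free v E i j) * visits i j v σ k)
  choices-visits v E (r ∷ σ) zero = begin
    ∑ (allFin n) (λ j → 𝟙 (free v E r j))
      ≡⟨ ∑-cong (allFin n) (λ {j} _ → ∑-select r (λ i → 𝟙 (free v E i j))) ⟨
    ∑ (allFin n) (λ j → ∑ (allFin n) (λ i → 𝟙 (free v E i j) * 𝟙 (does (r ≟ i))))
      ≡⟨ ∑-swap (allFin n) (allFin n) _ ⟩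
    ∑∑ (λ i j → 𝟙 (free v E i j) * 𝟙 (does (r ≟ i)))
      ≡⟨ ∑∑-cong (λ i j → cong (λ b → 𝟙 (free v E i j) * 𝟙 b) (does-≟-sym r i)) ⟩
    ∑∑ (λ i j → 𝟙 (free v E i j) * 𝟙 (does (i ≟ r))) ∎
    where open ≡-Reasoning
  choices-visits v E (r ∷ σ) (suc k) = trans (choices-visits v (r ∷ E) σ k) (∑∑-cong λ i j →
    trans (cong (_* visits i j v σ k) (trans (𝟙-∧ (Board.safe (lookup v) r i j) (free v E i j)) (*-comm (𝟙 (Board.safe (lookup v) r i j)) (𝟙 (free v E i j)))))
      (*-assoc (𝟙 (free v E i j)) (𝟙 (Board.safe (lookup v) r i j)) _))

  all-rows : Vec (Fin n) n
  all-rows = Vec.tabulate id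

  ∑-choices : ∀ v k → ∑ (orders all-rows) (λ σ → choices v [] σ k) ≡
    ∑∑ (λ i j → falling (Board.#safe (lookup v) i j) (toℕ k) * (n ∸ suc (toℕ k)) !)
  ∑-choices v k = begin
    ∑ (orders all-rows) (λ σ → choices v [] σ k)
      ≡⟨ ∑-cong (orders all-rows) (λ {σ} _ → choices-visits v [] σ k) ⟩
    ∑ (orders all-rows) (λ σ → ∑∑ (λ i j → 1 * visits i j v σ k))
      ≡⟨ trans (∑-swap (orders all-rows) (allFin n) _) (∑-cong (allFin n) (λ _ → ∑-swap (orders all-rows) (allFin n) _)) ⟩
    ∑∑ (λ i j → ∑ (orders all-rows) (λ σ → 1 * visits i j v σ k))
      ≡⟨ ∑∑-cong (λ i j → trans (∑-cong (orders all-rows) (λ _ → *-identityˡ _)) (per-square i j)) ⟩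
    ∑∑ (λ i j → falling (Board.#safe (lookup v) i j) (toℕ k) * (n ∸ suc (toℕ k)) !) ∎
    where
    open ≡-Reasoning
    per-square : ∀ i j → ∑ (orders all-rows) (λ σ → visits i j v σ k) ≡
      falling (Board.#safe (lookup v) i j) (toℕ k) * (n ∸ suc (toℕ k)) !
    per-square i j = trans (∑-visits i j v all-rows k) (cong (_* (n ∸ suc (toℕ k)) !)
      (trans (cong₂ (λ a b → a * falling b (toℕ k))
        (trans (cong (λ R → ∑ R (λ r → 𝟙 (does (i ≟ r)))) (toList-tabulate id)) (∑-indicator i))
        (cong (λ R → ∑ R (λ r → 𝟙 (Board.safe (lookup v) r i j))) (toList-tabulate id)))
        (*-identityˡ _)))

  IsSolution : Vec (Fin n) n → Set
  IsSolution v = ∀ {r s} → r ≢ s → nonAttacking (toℕ r , toℕ (lookup v r)) (toℕ s , toℕ (lookup v s)) ≡ true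

  solution-valid : ∀ {m} v → IsSolution v → ∀ E (σ : Vec (Fin n) m) → Unique (toList σ) →
    (∀ {e r} → e ∈ E → r ∈ toList σ → e ≢ r) → Valid v E σ
  solution-valid v sol E [] σ! apart = _
  solution-valid v sol E (r ∷ σ) (r∉σ ∷ σ!) apart =
    all-safe E (λ e∈E → apart e∈E (here refl)) ,
    solution-valid v sol (r ∷ E) σ σ! λ where
      (here refl) r′∈σ → All.lookup r∉σ r′∈σ
      (there e∈E) r′∈σ → apart e∈E (there r′∈σ)
    where
    all-safe : ∀ E → (∀ {e} → e ∈ E → e ≢ r) → free v E r (lookup v r) ≡ true
    all-safe [] apart = refl
    all-safe (e ∷ E) apart with r ≟ e
    ... | yes r≡e = ⊥-elim (apart (here refl) (sym r≡e))
    ... | no r≢e rewrite sol (≢-sym r≢e) = all-safe E (apart ∘ there)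

  module _ {σ : Vec (Fin n) n} (σ∈ : σ ∈ orders all-rows) where

    order-↭ : toList σ ↭ allFin n
    order-↭ = subst (toList σ ↭_) (toList-tabulate id) (orders-↭ all-rows σ∈)

    order-unique : Unique (toList σ)
    order-unique = ↭ₛ.Unique-resp-↭ (setoid (Fin n)) (↭.↭⇒↭ₛ (↭-sym order-↭)) (allFin⁺ n)

    order-complete : ∀ r → r ∈ toList σ
    order-complete r = ∈-resp-↭ (↭-sym order-↭) (∈-allFin r)

  module _ (W : List (Vec (Fin n) n)) (W! : Unique W) (sol : ∀ {v} → v ∈ W → IsSolution v) (4≤n : 4 ≤ n) where

    private
      S = orders all-rows
      o = length S
      w = length W
      γ = 8 * (n * n)
      β = λ (k : Fin n) → level n (n ∸ toℕ k)

    entropy-bound : ∀ {σ} → σ ∈ S → w ^ w ≤ ∏ W (λ v → ∏ (allFin n) (choices v [] σ))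
    entropy-bound {σ} σ∈ = chain-rule free-cong [] σ W W! (λ _ _ ())
      (λ {v} v∈W → solution-valid v (sol v∈W) [] σ (order-unique σ∈) (λ ()))
      (λ _ agree → lookup-ext (λ r → agree (order-complete σ∈ r)))
      where
      lookup-ext : ∀ {m} {u v : Vec (Fin n) m} → (∀ r → lookup u r ≡ lookup v r) → u ≡ v
      lookup-ext {u = []} {[]} eq = refl
      lookup-ext {u = _ ∷ _} {_ ∷ _} eq = cong₂ _∷_ (eq zero) (lookup-ext (eq ∘ suc))

    geometric-mean : ∀ {v} → v ∈ W → ∀ k → γ ^ o * ∏ S (λ σ → choices v [] σ k) ≤ β k ^ o
    geometric-mean {v} v∈W k = *-cancelˡ-≤ (o ^ o) {{>-nonZero (n^n>0 o)}} (begin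
      o ^ o * (γ ^ o * P)       ≡⟨ eq (o ^ o) (γ ^ o) P ⟩
      γ ^ o * (o ^ o * P)       ≤⟨ *-monoʳ-≤ (γ ^ o) (amgm S (λ σ → choices v [] σ k)) ⟩
      γ ^ o * ∑ S (λ σ → choices v [] σ k) ^ o   ≡⟨ ^-distribʳ-* γ _ o ⟨
      (γ * ∑ S (λ σ → choices v [] σ k)) ^ o     ≤⟨ ^-monoˡ-≤ o average ⟩
      (o * β k) ^ o             ≡⟨ ^-distribʳ-* o (β k) o ⟩
      o ^ o * β k ^ o           ∎)
      where
      open ≤-Reasoning
      P = ∏ S (λ σ → choices v [] σ k)
      eq : ∀ a b p → a * (b * p) ≡ b * (a * p)
      eq = solve-∀
      average : γ * ∑ S (λ σ → choices v [] σ k) ≤ o * β k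
      average = begin
        γ * ∑ S (λ σ → choices v [] σ k)    ≡⟨ cong (γ *_) (∑-choices v k) ⟩
        γ * ∑∑ (λ i j → falling (Board.#safe (lookup v) i j) (toℕ k) * (n ∸ suc (toℕ k)) !)
                                            ≤⟨ Levels.level-average (lookup v) (sol v∈W) 4≤n k ⟩
        n ! * β k                           ≡⟨ cong (_* β k) (length-orders all-rows) ⟨
        o * β k                             ∎

    -- The entropy bounds of all `o` orders are multiplied. Exchanging the products brings the one
    -- over the orders innermost, where solution and level are fixed and `geometric-mean` applies.
    powers-bound : (w * γ ^ n) ^ (o * w) ≤ ∏ (allFin n) β ^ (o * w)
    powers-bound = begin
      (w * γ ^ n) ^ (o * w)            ≡⟨ ^-distribʳ-* w (γ ^ n) (o * w) ⟩
      w ^ (o * w) * (γ ^ n) ^ (o * w)  ≡⟨ *-comm (w ^ (o * w)) _ ⟩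
      (γ ^ n) ^ (o * w) * w ^ (o * w)  ≡⟨ cong₂ _*_ exps (trans (cong (w ^_) (*-comm o w)) (sym (^-*-assoc w w o))) ⟩
      ((γ ^ o) ^ n) ^ w * (w ^ w) ^ o  ≡⟨ cong (((γ ^ o) ^ n) ^ w *_) (∏-const S (w ^ w)) ⟨
      ((γ ^ o) ^ n) ^ w * ∏ S (λ _ → w ^ w)
        ≤⟨ *-monoʳ-≤ (((γ ^ o) ^ n) ^ w) (∏-mono S entropy-bound) ⟩
      ((γ ^ o) ^ n) ^ w * ∏ S (λ σ → ∏ W (λ v → ∏ (allFin n) (choices v [] σ)))
        ≡⟨ cong₂ _*_ (sym (∏-const W ((γ ^ o) ^ n))) (trans (∏-swap S W _) (∏-cong W (λ _ → ∏-swap S (allFin n) _))) ⟩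
      ∏ W (λ _ → (γ ^ o) ^ n) * ∏ W (λ v → ∏ (allFin n) (λ k → ∏ S (λ σ → choices v [] σ k)))
        ≡⟨ ∏-distrib-* W (λ _ → (γ ^ o) ^ n) (λ v → ∏ (allFin n) (λ k → ∏ S (λ σ → choices v [] σ k))) ⟨
      ∏ W (λ v → (γ ^ o) ^ n * ∏ (allFin n) (λ k → ∏ S (λ σ → choices v [] σ k)))
        ≤⟨ ∏-mono W (λ {v} v∈W → per-solution v v∈W) ⟩
      ∏ W (λ _ → ∏ (allFin n) β ^ o)  ≡⟨ trans (∏-const W _) (^-*-assoc (∏ (allFin n) β) o w) ⟩
      ∏ (allFin n) β ^ (o * w)        ∎
      where
      open ≤-Reasoning
      exps : (γ ^ n) ^ (o * w) ≡ ((γ ^ o) ^ n) ^ w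
      exps = trans (sym (^-*-assoc (γ ^ n) o w)) (cong (_^ w)
        (trans (^-*-assoc γ n o) (trans (cong (γ ^_) (*-comm n o)) (sym (^-*-assoc γ o n)))))
      per-solution : ∀ v → v ∈ W →
        (γ ^ o) ^ n * ∏ (allFin n) (λ k → ∏ S (λ σ → choices v [] σ k)) ≤ ∏ (allFin n) β ^ o
      per-solution v v∈W = begin
        (γ ^ o) ^ n * ∏ (allFin n) P         ≡⟨ cong (_* ∏ (allFin n) P) (trans (∏-const (allFin n) (γ ^ o)) (cong ((γ ^ o) ^_) (length-allFin n))) ⟨
        ∏ (allFin n) (λ _ → γ ^ o) * ∏ (allFin n) P  ≡⟨ ∏-distrib-* (allFin n) (λ _ → γ ^ o) P ⟨
        ∏ (allFin n) (λ k → γ ^ o * P k)     ≤⟨ ∏-mono (allFin n) (λ {k} _ → geometric-mean v∈W k) ⟩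
        ∏ (allFin n) (λ k → β k ^ o)         ≡⟨ ∏-^ (allFin n) o β ⟩
        ∏ (allFin n) β ^ o                   ∎
        where P = λ k → ∏ S (λ σ → choices v [] σ k)

    count-bound : w * γ ^ n ≤ ∏ (allFin n) β
    count-bound = by-cases (n≡0⊎n>0 w)
      where
      n≡0⊎n>0 : ∀ m → m ≡ 0 ⊎ 0 < m
      n≡0⊎n>0 zero = inj₁ refl
      n≡0⊎n>0 (suc m) = inj₂ (s≤s z≤n)
      o>0 : 0 < o
      o>0 = subst (0 <_) (sym (length-orders all-rows)) (1≤n! n)
      by-cases : w ≡ 0 ⊎ 0 < w → w * γ ^ n ≤ ∏ (allFin n) β
      -- For empty W the exponent `o * w` is 0, and no root can be taken.
      by-cases (inj₁ w≡0) = ≤-trans (≤-reflexive (cong (_* γ ^ n) w≡0)) z≤n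
      by-cases (inj₂ w>0) = ^-cancelʳ-≤ _ _ (o * w) (*-mono-≤ o>0 w>0) powers-bound

-- The solutions counted by `Q`

≡ᵇ-sym : ∀ x y → (x ≡ᵇ y) ≡ (y ≡ᵇ x)
≡ᵇ-sym zero zero = refl
≡ᵇ-sym zero (suc y) = refl
≡ᵇ-sym (suc x) zero = refl
≡ᵇ-sym (suc x) (suc y) = ≡ᵇ-sym x y

nonAttacking-sym : ∀ p q → nonAttacking p q ≡ nonAttacking q p
nonAttacking-sym (i , a) (j , b) = cong₂ _∧_ (cong not (≡ᵇ-sym a b))
  (cong₂ _∧_ (cong not (≡ᵇ-sym (i + b) (j + a))) (cong not (≡ᵇ-sym (i + a) (j + b))))

∧-true : ∀ {a b} → a ∧ b ≡ true → a ≡ true × b ≡ true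
∧-true {true} eq = refl , eq

allB-lookup : ∀ {A : Set} (f : A → Bool) {xs x} → allB f xs ≡ true → x ∈ xs → f x ≡ true
allB-lookup f all (here refl) = proj₁ (∧-true all)
allB-lookup f all (there {y} x∈) = allB-lookup f (proj₂ (∧-true {f y} all)) x∈

-- `queenSquares` is the case `f = id`. The tail of `upTo n` is `applyUpTo` of a shifted function,
-- so inductions have to vary the row labels.
squares : ∀ {n m} → (ℕ → ℕ) → Vec (Fin n) m → List (ℕ × ℕ)
squares {m = m} f v = zip (applyUpTo f m) (map toℕ (toList v))

square-∈ : ∀ {n m} f (v : Vec (Fin n) m) r → (f (toℕ r) , toℕ (lookup v r)) ∈ squares f v
square-∈ f (x ∷ v) zero = here refl
square-∈ f (x ∷ v) (suc r) = there (square-∈ (f ∘ suc) v r)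

pairwiseOK-lookup : ∀ {n m} f (v : Vec (Fin n) m) → pairwiseOK (squares f v) ≡ true → ∀ {r s} → toℕ r < toℕ s →
  nonAttacking (f (toℕ r) , toℕ (lookup v r)) (f (toℕ s) , toℕ (lookup v s)) ≡ true
pairwiseOK-lookup f (x ∷ v) ok {zero} {suc s} r<s = allB-lookup _ (proj₁ (∧-true ok)) (square-∈ (f ∘ suc) v s)
pairwiseOK-lookup f (x ∷ v) ok {suc r} {suc s} r<s =
  pairwiseOK-lookup (f ∘ suc) v (proj₂ (∧-true {allB (nonAttacking (f 0 , toℕ x)) (squares (f ∘ suc) v)} ok)) (s≤s⁻¹ r<s)

isSolution-sound : ∀ {n} (v : Vec (Fin n) n) → isSolution v ≡ true → Free.IsSolution v
isSolution-sound v ok {r} {s} r≢s with <-cmp (toℕ r) (toℕ s)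
... | tri< r<s _ _ = pairwiseOK-lookup id v ok r<s
... | tri≈ _ r≡s _ = ⊥-elim (r≢s (toℕ-injective r≡s))
... | tri> _ _ s<r = trans (nonAttacking-sym (toℕ r , toℕ (lookup v r)) (toℕ s , toℕ (lookup v s))) (pairwiseOK-lookup id v ok s<r)

allVecs-unique : ∀ n k → Unique (allVecs n k)
allVecs-unique n zero = All.[] ∷ []
allVecs-unique n (suc k) = concat⁺
  (All.map⁺ (All.universal (λ x → map⁺ ∷-injectiveʳ (allVecs-unique n k)) (allFin n)))
  (AllPairs.map⁺ (AllPairs.map (λ {x} {y} x≢y {v} (p , q) → disjoint x y x≢y p q) (allFin⁺ n)))
  where
  disjoint : ∀ x y → x ≢ y → ∀ {v} → v ∈ map (x ∷_) (allVecs n k) → v ∈ map (y ∷_) (allVecs n k) → ⊥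
  disjoint x y x≢y p q with _ , _ , eq₁ ← ∈-map⁻ (x ∷_) p | _ , _ , eq₂ ← ∈-map⁻ (y ∷_) q =
    x≢y (∷-injectiveˡ (trans (sym eq₁) eq₂))

Q-level-bound : ∀ n → 4 ≤ n → Q n * (8 * (n * n)) ^ n ≤ ∏ (allFin n) (λ k → level n (n ∸ toℕ k))
Q-level-bound n 4≤n = Free.count-bound (filter (λ v → T? (isSolution v)) (allVecs n n))
  (filter⁺ (λ v → T? (isSolution v)) (allVecs-unique n n))
  (λ {v} v∈ → isSolution-sound v (T⇒true (proj₂ (∈-filter⁻ (λ v → T? (isSolution v)) {xs = allVecs n n} v∈))))
  4≤n

-- The product over the levels

∏₁ : ℕ → (ℕ → ℕ) → ℕ
∏₁ zero f = 1
∏₁ (suc n) f = f (suc n) * ∏₁ n f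

∏-allFin-∏₁ : ∀ n f → ∏ (allFin n) (λ k → f (n ∸ toℕ k)) ≡ ∏₁ n f
∏-allFin-∏₁ zero f = refl
∏-allFin-∏₁ (suc n) f = trans (∏-allFin-suc n (λ k → f (suc n ∸ toℕ k))) (cong (f (suc n) *_) (∏-allFin-∏₁ n f))

∏₁-distrib-* : ∀ n f g → ∏₁ n (λ l → f l * g l) ≡ ∏₁ n f * ∏₁ n g
∏₁-distrib-* zero f g = refl
∏₁-distrib-* (suc n) f g = trans (cong (f (suc n) * g (suc n) *_) (∏₁-distrib-* n f g)) (*-interchange (f (suc n)) _ _ _)

∏₁-+ : ∀ m n f → ∏₁ (m + n) f ≡ ∏₁ m (λ i → f (i + n)) * ∏₁ n f
∏₁-+ zero n f = sym (+-identityʳ (∏₁ n f))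
∏₁-+ (suc m) n f = trans (cong (f (suc (m + n)) *_) (∏₁-+ m n f)) (sym (*-assoc (f (suc (m + n))) _ _))

∏₁-bound : ∀ n {f a b} → (∀ {i} → i ≤ n → f i * a ≤ b) → ∏₁ n f * a ^ n ≤ b ^ n
∏₁-bound zero le = ≤-refl
∏₁-bound (suc n) {f} {a} le = ≤-trans (≤-reflexive (*-interchange (f (suc n)) (∏₁ n f) a (a ^ n)))
  (*-mono-≤ (le ≤-refl) (∏₁-bound n (le ∘ m≤n⇒m≤1+n)))

∏₁-shifted : ∀ n → ∏₁ n (_+ 3) * 6 ≡ n ! * ((1 + n) * ((2 + n) * (3 + n)))
∏₁-shifted zero = refl
∏₁-shifted (suc n) = trans (*-assoc (suc n + 3) (∏₁ n (_+ 3)) 6) (trans (cong ((suc n + 3) *_) (∏₁-shifted n)) (eq n (n !)))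
  where
  eq : ∀ n f → (1 + n + 3) * (f * ((1 + n) * ((2 + n) * (3 + n)))) ≡ (1 + n) * f * ((2 + n) * ((3 + n) * (4 + n)))
  eq = solve-∀

-- The product is (ν + 4)! / 6, so it exceeds ν ! by a polynomial factor only.
∏₁-shifted-bound : ∀ ν → ∏₁ (suc ν) (_+ 3) ≤ ν ! * (ν + 4) ^ 4
∏₁-shifted-bound ν = begin
  ∏₁ n (_+ 3)                                         ≤⟨ m≤m*n (∏₁ n (_+ 3)) 6 ⟩
  ∏₁ n (_+ 3) * 6                                     ≡⟨ ∏₁-shifted n ⟩
  suc ν * ν ! * ((1 + n) * ((2 + n) * (3 + n)))       ≡⟨ eq (suc ν) (ν !) _ ⟩
  ν ! * (suc ν * ((1 + n) * ((2 + n) * (3 + n))))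
    ≤⟨ *-monoʳ-≤ (ν !) (*-mono-≤ (le 1 (≤ᵇ⇒≤ _ _ _)) (*-mono-≤ (le 2 (≤ᵇ⇒≤ _ _ _)) (*-mono-≤ (le 3 (≤ᵇ⇒≤ _ _ _))
         (≤-trans (le 4 ≤-refl) (≤-reflexive (sym (*-identityʳ (ν + 4)))))))) ⟩
  ν ! * (ν + 4) ^ 4                                   ∎
  where
  open ≤-Reasoning
  n = suc ν
  le : ∀ a → a ≤ 4 → a + ν ≤ ν + 4
  le a a≤4 = ≤-trans (+-monoˡ-≤ ν a≤4) (≤-reflexive (+-comm 4 ν))
  eq : ∀ s f g → s * f * g ≡ f * (s * g)
  eq = solve-∀

-- The factor (3 + 5 t²) / 8 is increasing in t = l / n; on the j-th of L blocks it is at most its value at t = j / L.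
module Blocks (L : ℕ) where

  -- Divided by (8L²)^L this is the product of (3 + 5t²) / 8 over t = j / L for j from 1 to L.
  K : ℕ
  K = ∏₁ L (λ j → 3 * (L * L) + 5 * (j * j))

  block-factor : ∀ {n w i} j → L * w ≤ n → i ≤ w →
    (3 * (n * n) + 5 * ((i + j * w) * (i + j * w))) * (8 * (L * L)) ≤ 8 * (n * n) * (3 * (L * L) + 5 * (suc j * suc j))
  block-factor {n} {w} {i} j Lw≤n i≤w = begin
    (3 * (n * n) + 5 * (l * l)) * (8 * (L * L))             ≡⟨ eq n l L ⟩
    24 * (n * n * (L * L)) + 40 * ((L * l) * (L * l))       ≤⟨ +-monoʳ-≤ (24 * (n * n * (L * L))) (*-monoʳ-≤ 40 (*-mono-≤ Ll≤ Ll≤)) ⟩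
    24 * (n * n * (L * L)) + 40 * ((n * s) * (n * s))       ≡⟨ eq₂ n L s ⟩
    8 * (n * n) * (3 * (L * L) + 5 * (s * s))               ∎
    where
    open ≤-Reasoning
    l = i + j * w
    s = suc j
    eq : ∀ n l L → (3 * (n * n) + 5 * (l * l)) * (8 * (L * L)) ≡ 24 * (n * n * (L * L)) + 40 * ((L * l) * (L * l))
    eq = solve-∀
    eq₂ : ∀ n L s → 24 * (n * n * (L * L)) + 40 * ((n * s) * (n * s)) ≡ 8 * (n * n) * (3 * (L * L) + 5 * (s * s))
    eq₂ = solve-∀
    eq₃ : ∀ L j w → L * ((1 + j) * w) ≡ L * w * (1 + j)
    eq₃ = solve-∀
    Ll≤ : L * l ≤ n * s
    Ll≤ = ≤-trans (*-monoʳ-≤ L (+-monoˡ-≤ (j * w) i≤w)) (≤-trans (≤-reflexive (eq₃ L j w)) (*-monoˡ-≤ s Lw≤n))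

  module _ (n w ρ : ℕ) (n≡ : n ≡ ρ + L * w) where

    private
      f = λ l → 3 * (n * n) + 5 * (l * l)
      g = λ j → 3 * (L * L) + 5 * (j * j)
      a = 8 * (L * L)
      γ = 8 * (n * n)

    blocks : ∀ j → ∏₁ (j * w) f * a ^ (j * w) ≤ γ ^ (j * w) * ∏₁ j g ^ w
    blocks zero = ≤-reflexive (cong (λ z → z + 0) (sym (^-zeroˡ w)))
    blocks (suc j) = begin
      ∏₁ (w + j * w) f * a ^ (w + j * w)      ≡⟨ cong₂ _*_ (∏₁-+ w (j * w) f) (^-distribˡ-+-* a w (j * w)) ⟩
      ∏₁ w f′ * ∏₁ (j * w) f * (a ^ w * a ^ (j * w))   ≡⟨ *-interchange (∏₁ w f′) _ _ _ ⟩
      ∏₁ w f′ * a ^ w * (∏₁ (j * w) f * a ^ (j * w))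
        ≤⟨ *-mono-≤ (∏₁-bound w (block-factor j (≤-trans (m≤n+m (L * w) ρ) (≤-reflexive (sym n≡))))) (blocks j) ⟩
      (γ * g (suc j)) ^ w * (γ ^ (j * w) * ∏₁ j g ^ w)    ≡⟨ cong (_* (γ ^ (j * w) * ∏₁ j g ^ w)) (^-distribʳ-* γ (g (suc j)) w) ⟩
      γ ^ w * g (suc j) ^ w * (γ ^ (j * w) * ∏₁ j g ^ w)  ≡⟨ *-interchange (γ ^ w) _ _ _ ⟩
      γ ^ w * γ ^ (j * w) * (g (suc j) ^ w * ∏₁ j g ^ w)
        ≡⟨ cong₂ _*_ (sym (^-distribˡ-+-* γ w (j * w))) (sym (^-distribʳ-* (g (suc j)) (∏₁ j g) w)) ⟩
      γ ^ (w + j * w) * (g (suc j) * ∏₁ j g) ^ w          ∎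
      where
      open ≤-Reasoning
      f′ = λ i → f (i + j * w)

    block-bound : ∏₁ n f * a ^ (L * w) ≤ γ ^ n * K ^ w
    block-bound = begin
      ∏₁ n f * a ^ (L * w)                              ≡⟨ cong (λ m → ∏₁ m f * a ^ (L * w)) n≡ ⟩
      ∏₁ (ρ + L * w) f * a ^ (L * w)                    ≡⟨ cong (_* a ^ (L * w)) (∏₁-+ ρ (L * w) f) ⟩
      ∏₁ ρ f′ * ∏₁ (L * w) f * a ^ (L * w)              ≡⟨ *-assoc (∏₁ ρ f′) _ _ ⟩
      ∏₁ ρ f′ * (∏₁ (L * w) f * a ^ (L * w))            ≤⟨ *-mono-≤ tail (blocks L) ⟩
      γ ^ ρ * (γ ^ (L * w) * K ^ w)                     ≡⟨ *-assoc (γ ^ ρ) _ _ ⟨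
      γ ^ ρ * γ ^ (L * w) * K ^ w                       ≡⟨ cong (_* K ^ w) (trans (sym (^-distribˡ-+-* γ ρ (L * w))) (cong (γ ^_) (sym n≡))) ⟩
      γ ^ n * K ^ w                                     ∎
      where
      open ≤-Reasoning
      f′ = λ i → f (i + L * w)
      eq : ∀ m → 3 * m + 5 * m ≡ 8 * m
      eq = solve-∀
      f≤γ : ∀ {l} → l ≤ n → f l ≤ γ
      f≤γ l≤n = ≤-trans (+-monoʳ-≤ (3 * (n * n)) (*-monoʳ-≤ 5 (*-mono-≤ l≤n l≤n))) (≤-reflexive (eq (n * n)))
      -- The ρ topmost levels, beyond the last full block, get the trivial factor 1.
      tail : ∏₁ ρ f′ ≤ γ ^ ρ
      tail = ≤-trans (≤-reflexive (sym (trans (cong (∏₁ ρ f′ *_) (^-zeroˡ ρ)) (*-identityʳ _))))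
        (∏₁-bound ρ (λ {i} i≤ρ → ≤-trans (≤-reflexive (*-identityʳ (f′ i))) (f≤γ (≤-trans (+-monoˡ-≤ (L * w) i≤ρ) (≤-reflexive (sym n≡))))))

    Q-block-bound : 4 ≤ n → Q n * (8 * (L * L)) ^ (L * w) ≤ ∏₁ n (_+ 3) * K ^ w
    Q-block-bound 4≤n = *-cancelˡ-≤ (γ ^ n) {{γ^n≢0}} (begin
      γ ^ n * (Q n * a ^ (L * w))              ≡⟨ eq (γ ^ n) (Q n) _ ⟩
      Q n * γ ^ n * a ^ (L * w)                ≤⟨ *-monoˡ-≤ (a ^ (L * w)) (Q-level-bound n 4≤n) ⟩
      ∏ (allFin n) (λ k → level n (n ∸ toℕ k)) * a ^ (L * w)
        ≡⟨ cong (_* a ^ (L * w)) (trans (∏-allFin-∏₁ n (level n)) (∏₁-distrib-* n (_+ 3) f)) ⟩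
      ∏₁ n (_+ 3) * ∏₁ n f * a ^ (L * w)       ≡⟨ *-assoc (∏₁ n (_+ 3)) _ _ ⟩
      ∏₁ n (_+ 3) * (∏₁ n f * a ^ (L * w))     ≤⟨ *-monoʳ-≤ (∏₁ n (_+ 3)) block-bound ⟩
      ∏₁ n (_+ 3) * (γ ^ n * K ^ w)            ≡⟨ eq₂ (∏₁ n (_+ 3)) (γ ^ n) _ ⟩
      γ ^ n * (∏₁ n (_+ 3) * K ^ w)            ∎)
      where
      open ≤-Reasoning
      eq : ∀ a b d → a * (b * d) ≡ b * a * d
      eq = solve-∀
      eq₂ : ∀ a b d → a * (b * d) ≡ b * (a * d)
      eq₂ = solve-∀
      n>0 : 0 < n
      n>0 = ≤-trans (s≤s z≤n) 4≤n
      γ^n≢0 : NonZero (γ ^ n)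
      γ^n≢0 = m^n≢0 γ n {{m*n≢0 8 (n * n) {{_}} {{m*n≢0 n n {{>-nonZero n>0}} {{>-nonZero n>0}}}}}}

-- The exponential function

-- expSum c a k = cᵏ k! Σ_{j ≤ k} (a/c)ʲ / j!
expSum : ℕ → ℕ → ℕ → ℕ
expSum c a zero = 1
expSum c a (suc k) = c * suc k * expSum c a k + a ^ suc k

suc-^-≤ : ∀ a k → suc a ^ suc k ≤ a ^ suc k + suc k * suc a ^ k
suc-^-≤ a k = +-cancelʳ-≤ (k * suc a ^ suc k) _ _ (begin
  suc a * Y + k * (suc a * Y)               ≡⟨ eq a k Y ⟩
  suc k * (a * Y) + suc k * Y               ≤⟨ +-monoˡ-≤ (suc k * Y) (power-tangent k a (suc a)) ⟩
  a ^ suc k + k * (suc a * Y) + suc k * Y   ≡⟨ eq₂ (a ^ suc k) (k * (suc a * Y)) (suc k * Y) ⟩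
  a ^ suc k + suc k * Y + k * (suc a * Y)   ∎)
  where
  open ≤-Reasoning
  Y = suc a ^ k
  eq : ∀ a k y → (1 + a) * y + k * ((1 + a) * y) ≡ (1 + k) * (a * y) + (1 + k) * y
  eq = solve-∀
  eq₂ : ∀ p q r → p + q + r ≡ p + r + q
  eq₂ = solve-∀

-- `suc k * expSum c a k` is the derivative of `expSum c a (suc k)` in a; by convexity an increment
-- is at most the derivative at its right end. For a single power this is `suc-^-≤`.
expSum-increment : ∀ c a k → expSum c (suc a) (suc k) ≤ expSum c a (suc k) + suc k * expSum c (suc a) k
expSum-increment c a zero = ≤-reflexive (eq c a)
  where
  eq : ∀ c a → c * 1 * 1 + (1 + a) * 1 ≡ c * 1 * 1 + a * 1 + 1 * 1
  eq = solve-∀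
expSum-increment c a (suc k) = begin
  c * suc (suc k) * expSum c (suc a) (suc k) + suc a ^ suc (suc k)
    ≤⟨ +-mono-≤ (*-monoʳ-≤ (c * suc (suc k)) (expSum-increment c a k)) (suc-^-≤ a (suc k)) ⟩
  c * suc (suc k) * (expSum c a (suc k) + suc k * S) + (a ^ suc (suc k) + suc (suc k) * suc a ^ suc k)
    ≡⟨ eq c (suc (suc k)) (suc k) (expSum c a (suc k)) S (a ^ suc (suc k)) (suc a ^ suc k) ⟩
  c * suc (suc k) * expSum c a (suc k) + a ^ suc (suc k) + suc (suc k) * (c * suc k * S + suc a ^ suc k) ∎
  where
  open ≤-Reasoning
  S = expSum c (suc a) k
  eq : ∀ c k₂ k₁ s t p q → c * k₂ * (s + k₁ * t) + (p + k₂ * q) ≡ c * k₂ * s + p + k₂ * (c * k₁ * t + q)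
  eq = solve-∀

-- e^{1/(d+1)} ≤ (d+1)/d
expSum-suc : ∀ d a k → d * expSum (suc d) (suc a) k ≤ suc d * expSum (suc d) a k
expSum-suc d a zero = *-monoˡ-≤ 1 (n≤1+n d)
expSum-suc d a (suc k) = +-cancelˡ-≤ S′ _ _ (begin
  c * S′                                                ≤⟨ *-monoʳ-≤ c (expSum-increment c a k) ⟩
  c * (S + suc k * expSum c (suc a) k)                  ≡⟨ eq c S (suc k) _ ⟩
  c * suc k * expSum c (suc a) k + c * S                ≤⟨ +-monoˡ-≤ (c * S) (m≤m+n (c * suc k * expSum c (suc a) k) (suc a ^ suc k)) ⟩
  S′ + c * S                                            ∎)
  where
  open ≤-Reasoning
  c = suc d
  S = expSum c a (suc k)
  S′ = expSum c (suc a) (suc k)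
  eq : ∀ c s k t → c * (s + k * t) ≡ c * k * t + c * s
  eq = solve-∀

expSum-+ : ∀ d i a k → d ^ i * expSum (suc d) (i + a) k ≤ suc d ^ i * expSum (suc d) a k
expSum-+ d zero a k = ≤-refl
expSum-+ d (suc i) a k = begin
  d * d ^ i * expSum c (suc (i + a)) k      ≡⟨ eq d (d ^ i) _ ⟩
  d ^ i * (d * expSum c (suc (i + a)) k)    ≤⟨ *-monoʳ-≤ (d ^ i) (expSum-suc d (i + a) k) ⟩
  d ^ i * (c * expSum c (i + a) k)          ≡⟨ eq c (d ^ i) _ ⟨
  c * d ^ i * expSum c (i + a) k            ≡⟨ *-assoc c (d ^ i) _ ⟩
  c * (d ^ i * expSum c (i + a) k)          ≤⟨ *-monoʳ-≤ c (expSum-+ d i a k) ⟩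
  c * (c ^ i * expSum c a k)                ≡⟨ *-assoc c (c ^ i) _ ⟨
  c * c ^ i * expSum c a k                  ∎
  where
  open ≤-Reasoning
  c = suc d
  eq : ∀ a b s → a * b * s ≡ b * (a * s)
  eq = solve-∀

-- Over the denominator c, a unit step of the exponent becomes c steps of length 1 / c, to which
-- `expSum-+` applies.
expSum-rescale : ∀ c a k → expSum c (c * a) k ≡ c ^ k * expSum 1 a k
expSum-rescale c a zero = refl
expSum-rescale c a (suc k) = trans (cong₂ (λ u v → c * suc k * u + v) (expSum-rescale c a k) (^-distribʳ-* c a (suc k)))
  (eq c (c ^ k) (suc k) (expSum 1 a k) (a ^ suc k))
  where
  eq : ∀ c p k s t → c * k * (p * s) + c * p * t ≡ c * p * (1 * k * s + t)
  eq = solve-∀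

-- e ≤ ((d+1)/d)^{d+1}
exp-unit-step : ∀ d x k → d ^ suc d * expSum 1 (suc x) k ≤ suc d ^ suc d * expSum 1 x k
exp-unit-step d x k = *-cancelˡ-≤ (c ^ k) {{m^n≢0 c k}} (begin
  c ^ k * (d ^ c * expSum 1 (suc x) k)      ≡⟨ eq (c ^ k) (d ^ c) _ ⟩
  d ^ c * (c ^ k * expSum 1 (suc x) k)      ≡⟨ cong (d ^ c *_) (expSum-rescale c (suc x) k) ⟨
  d ^ c * expSum c (c * suc x) k            ≡⟨ cong (λ z → d ^ c * expSum c z k) (*-suc c x) ⟩
  d ^ c * expSum c (c + c * x) k            ≤⟨ expSum-+ d c (c * x) k ⟩
  c ^ c * expSum c (c * x) k                ≡⟨ cong (c ^ c *_) (expSum-rescale c x k) ⟩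
  c ^ c * (c ^ k * expSum 1 x k)            ≡⟨ eq (c ^ c) (c ^ k) _ ⟩
  c ^ k * (c ^ c * expSum 1 x k)            ∎)
  where
  open ≤-Reasoning
  c = suc d
  eq : ∀ a b s → a * (b * s) ≡ b * (a * s)
  eq = solve-∀

-- eˣ ≤ a / b
ExpBound : ℕ → ℕ → ℕ → Set
ExpBound x a b = ∀ k → expSum 1 x k * b ≤ k ! * a

expSum-zero : ∀ k → expSum 1 0 k ≡ k !
expSum-zero zero = refl
expSum-zero (suc k) = trans (+-identityʳ _) (cong₂ _*_ (+-identityʳ (suc k)) (expSum-zero k))

ExpBound-zero : ExpBound 0 1 1
ExpBound-zero k = *-monoˡ-≤ 1 (≤-reflexive (expSum-zero k))

ExpBound-cancel : ∀ {x a b} e → 0 < e → ExpBound x (a * e) (b * e) → ExpBound x a b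
ExpBound-cancel {x} {a} {b} e e>0 bound k = *-cancelʳ-≤ _ _ e {{>-nonZero e>0}} (begin
  expSum 1 x k * b * e     ≡⟨ *-assoc (expSum 1 x k) b e ⟩
  expSum 1 x k * (b * e)   ≤⟨ bound k ⟩
  k ! * (a * e)            ≡⟨ *-assoc (k !) a e ⟨
  k ! * a * e              ∎)
  where open ≤-Reasoning

ExpBound-suc : ∀ {x a b} d → ExpBound x a b → ExpBound (suc x) (a * suc d ^ suc d) (b * d ^ suc d)
ExpBound-suc {x} {a} {b} d bound k = begin
  expSum 1 (suc x) k * (b * d ^ c)     ≡⟨ eq (expSum 1 (suc x) k) b (d ^ c) ⟩
  d ^ c * expSum 1 (suc x) k * b       ≤⟨ *-monoˡ-≤ b (exp-unit-step d x k) ⟩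
  c ^ c * expSum 1 x k * b             ≡⟨ *-assoc (c ^ c) _ b ⟩
  c ^ c * (expSum 1 x k * b)           ≤⟨ *-monoʳ-≤ (c ^ c) (bound k) ⟩
  c ^ c * (k ! * a)                    ≡⟨ eq₂ (c ^ c) (k !) a ⟩
  k ! * (a * c ^ c)                    ∎
  where
  open ≤-Reasoning
  c = suc d
  eq : ∀ s b p → s * (b * p) ≡ p * s * b
  eq = solve-∀
  eq₂ : ∀ p f a → p * (f * a) ≡ f * (a * p)
  eq₂ = solve-∀

ExpBound-iterate : ∀ {u v} → (∀ {x a b} → ExpBound x a b → ExpBound (suc x) (a * u) (b * v)) →
  ∀ q {x a b} → ExpBound x a b → ExpBound (q + x) (a * u ^ q) (b * v ^ q)
ExpBound-iterate step zero {x} {a} {b} bound = subst₂ (ExpBound x) (sym (*-identityʳ a)) (sym (*-identityʳ b)) bound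
ExpBound-iterate {u} {v} step (suc q) {x} {a} {b} bound =
  subst₂ (ExpBound (suc q + x)) (eq a (u ^ q) u) (eq b (v ^ q) v) (step (ExpBound-iterate step q bound))
  where
  eq : ∀ a p u → a * p * u ≡ a * (u * p)
  eq = solve-∀

-- n! e^{n-1} ≤ nⁿ n for n = ν + 1, raised to the power q
ExpBound-factorial : ∀ q ν → ExpBound (q * ν) ((suc ν ^ suc ν) ^ q) ((ν !) ^ q)
ExpBound-factorial q zero = subst₂ (λ x a → ExpBound x a (1 ^ q)) (sym (*-zeroʳ q)) (sym (cong (_^ q) (^-zeroˡ 1)))
  (subst₂ (ExpBound 0) (sym (^-zeroˡ q)) (sym (^-zeroˡ q)) ExpBound-zero)
ExpBound-factorial q (suc ν) = ExpBound-cancel (e ^ q) (m^n>0 e {{m^n≢0 (suc ν) (suc ν)}} q)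
  (subst₂ (λ a b → ExpBound (q * suc ν) a b) num den
    (subst (λ x → ExpBound x (e ^ q * (g ^ q)) ((ν !) ^ q * (h ^ q))) (sym (*-suc q ν))
      -- At d = ν + 1 the bound ((d+1)/d)^(d+1) is exactly the quotient of the claims for ν + 1 and
      -- ν; cancelling `e` leaves no error behind.
      (ExpBound-iterate (ExpBound-suc (suc ν)) q (ExpBound-factorial q ν))))
  where
  e = suc ν ^ suc ν
  g = suc (suc ν) ^ suc (suc ν)
  h = suc ν ^ suc (suc ν)
  num : e ^ q * g ^ q ≡ g ^ q * e ^ q
  num = *-comm (e ^ q) _
  den : (ν !) ^ q * h ^ q ≡ ((suc ν) !) ^ q * e ^ q
  den = trans (sym (^-distribʳ-* (ν !) h q)) (trans (cong (_^ q) (eq (ν !) (suc ν) e)) (^-distribʳ-* ((suc ν) !) e q))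
    where
    eq : ∀ f s e → f * (s * e) ≡ s * f * e
    eq = solve-∀

-- Replaces the huge fraction ((d+1)/d)^(d+1) by one with small terms, whose high powers can still
-- be compared by evaluation.
ExpBound-ratio : ∀ {u v} d → 0 < d → v * suc d ^ suc d ≤ u * d ^ suc d →
  ∀ {x a b} → ExpBound x a b → ExpBound (suc x) (a * u) (b * v)
ExpBound-ratio {u} {v} d d>0 e≤ {x} {a} {b} bound = ExpBound-cancel p (m^n>0 d {{>-nonZero d>0}} (suc d)) λ k → begin
  expSum 1 (suc x) k * (b * v * p)     ≡⟨ eq (expSum 1 (suc x) k) b v p ⟩
  expSum 1 (suc x) k * (b * p) * v     ≤⟨ *-monoˡ-≤ v (ExpBound-suc d bound k) ⟩
  k ! * (a * suc d ^ suc d) * v        ≡⟨ eq₂ (k !) a (suc d ^ suc d) v ⟩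
  k ! * a * (v * suc d ^ suc d)        ≤⟨ *-monoʳ-≤ (k ! * a) e≤ ⟩
  k ! * a * (u * p)                    ≡⟨ eq₃ (k !) a u p ⟩
  k ! * (a * u * p)                    ∎
  where
  open ≤-Reasoning
  p = d ^ suc d
  eq : ∀ s b v p → s * (b * v * p) ≡ s * (b * p) * v
  eq = solve-∀
  eq₂ : ∀ f a g v → f * (a * g) * v ≡ f * a * (v * g)
  eq₂ = solve-∀
  eq₃ : ∀ f a u p → f * a * (u * p) ≡ f * (a * u * p)
  eq₃ = solve-∀

-- Rational partial sums of the exponential series

ℕ→ℚ-* : ∀ m n → ℕ→ℚ (m * n) ≡ ℕ→ℚ m ℚ.* ℕ→ℚ n
ℕ→ℚ-* m n = ℚ.toℚᵘ-injective (begin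
  toℚᵘ (ℕ→ℚ (m * n))                        ≈⟨ ℚ.toℚᵘ-fromℚᵘ (mkℚᵘ (ℤ.+ (m * n)) 0) ⟩
  mkℚᵘ (ℤ.+ (m * n)) 0                        ≈⟨ *≡* (cong (ℤ._* ℤ.+ 1) (ℤ.pos-* m n)) ⟩
  mkℚᵘ (ℤ.+ m) 0 ℚᵘ.* mkℚᵘ (ℤ.+ n) 0            ≈⟨ ℚᵘ.*-cong (ℚ.toℚᵘ-fromℚᵘ (mkℚᵘ (ℤ.+ m) 0)) (ℚ.toℚᵘ-fromℚᵘ (mkℚᵘ (ℤ.+ n) 0)) ⟨
  toℚᵘ (ℕ→ℚ m) ℚᵘ.* toℚᵘ (ℕ→ℚ n)            ≈⟨ ℚ.toℚᵘ-homo-* (ℕ→ℚ m) (ℕ→ℚ n) ⟨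
  toℚᵘ (ℕ→ℚ m ℚ.* ℕ→ℚ n)                    ∎)
  where open ℚᵘ.≃-Reasoning

ℕ→ℚ-+ : ∀ m n → ℕ→ℚ (m + n) ≡ ℕ→ℚ m ℚ.+ ℕ→ℚ n
ℕ→ℚ-+ m n = ℚ.toℚᵘ-injective (begin
  toℚᵘ (ℕ→ℚ (m + n))                        ≈⟨ ℚ.toℚᵘ-fromℚᵘ (mkℚᵘ (ℤ.+ (m + n)) 0) ⟩
  mkℚᵘ (ℤ.+ (m + n)) 0
    ≈⟨ *≡* (cong (ℤ._* ℤ.+ 1) (trans (ℤ.pos-+ m n) (cong₂ ℤ._+_ (sym (ℤ.*-identityʳ (ℤ.+ m))) (sym (ℤ.*-identityʳ (ℤ.+ n)))))) ⟩
  mkℚᵘ (ℤ.+ m) 0 ℚᵘ.+ mkℚᵘ (ℤ.+ n) 0            ≈⟨ ℚᵘ.+-cong (ℚ.toℚᵘ-fromℚᵘ (mkℚᵘ (ℤ.+ m) 0)) (ℚ.toℚᵘ-fromℚᵘ (mkℚᵘ (ℤ.+ n) 0)) ⟨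
  toℚᵘ (ℕ→ℚ m) ℚᵘ.+ toℚᵘ (ℕ→ℚ n)            ≈⟨ ℚ.toℚᵘ-homo-+ (ℕ→ℚ m) (ℕ→ℚ n) ⟨
  toℚᵘ (ℕ→ℚ m ℚ.+ ℕ→ℚ n)                    ∎)
  where open ℚᵘ.≃-Reasoning

/-cancel : ∀ x j → ((ℤ.+ x) ℚ./ suc j) ℚ.* ℕ→ℚ (suc j) ≡ ℕ→ℚ x
/-cancel x j = ℚ.toℚᵘ-injective (begin
  toℚᵘ ((ℤ.+ x) ℚ./ suc j ℚ.* ℕ→ℚ (suc j))           ≈⟨ ℚ.toℚᵘ-homo-* ((ℤ.+ x) ℚ./ suc j) (ℕ→ℚ (suc j)) ⟩
  toℚᵘ ((ℤ.+ x) ℚ./ suc j) ℚᵘ.* toℚᵘ (ℕ→ℚ (suc j))   ≈⟨ ℚᵘ.*-cong (ℚ.toℚᵘ-fromℚᵘ (mkℚᵘ (ℤ.+ x) j)) (ℚ.toℚᵘ-fromℚᵘ (mkℚᵘ (ℤ.+ suc j) 0)) ⟩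
  mkℚᵘ (ℤ.+ x) j ℚᵘ.* mkℚᵘ (ℤ.+ suc j) 0               ≈⟨ *≡* (trans (ℤ.*-identityʳ _) (cong (λ z → ℤ.+ x ℤ.* ℤ.+ z) (sym (*-identityʳ (suc j))))) ⟩
  mkℚᵘ (ℤ.+ x) 0                                     ≈⟨ ℚ.toℚᵘ-fromℚᵘ (mkℚᵘ (ℤ.+ x) 0) ⟨
  toℚᵘ (ℕ→ℚ x)                                     ∎)
  where open ℚᵘ.≃-Reasoning

ℕ→ℚ-mono : ∀ {m n} → m ≤ n → ℕ→ℚ m ℚ.≤ ℕ→ℚ n
ℕ→ℚ-mono {m} {n} m≤n = ℚ.toℚᵘ-cancel-≤ (begin
  toℚᵘ (ℕ→ℚ m)   ≃⟨ ℚ.toℚᵘ-fromℚᵘ (mkℚᵘ (ℤ.+ m) 0) ⟩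
  mkℚᵘ (ℤ.+ m) 0   ≤⟨ *≤* (ℤ.*-monoʳ-≤-nonNeg (ℤ.+ 1) (ℤ.+≤+ m≤n)) ⟩
  mkℚᵘ (ℤ.+ n) 0   ≃⟨ ℚ.toℚᵘ-fromℚᵘ (mkℚᵘ (ℤ.+ n) 0) ⟨
  toℚᵘ (ℕ→ℚ n)   ∎)
  where open ℚᵘ.≤-Reasoning

ℚ-interchange : ∀ a b c d → (a ℚ.* b) ℚ.* (c ℚ.* d) ≡ (a ℚ.* c) ℚ.* (b ℚ.* d)
ℚ-interchange = interchange (CommutativeMonoid.commutativeSemigroup ℚ.*-1-commutativeMonoid)

expTerm-! : ∀ x j → expTerm x j ℚ.* ℕ→ℚ (j !) ≡ ℕ→ℚ (x ^ j)
expTerm-! x zero = ℚ.*-identityˡ (ℕ→ℚ 1)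
expTerm-! x (suc j) = begin
  (expTerm x j ℚ.* ((ℤ.+ x) ℚ./ suc j)) ℚ.* ℕ→ℚ (suc j * j !)             ≡⟨ cong (expTerm x (suc j) ℚ.*_) (trans (cong ℕ→ℚ (*-comm (suc j) (j !))) (ℕ→ℚ-* (j !) (suc j))) ⟩
  (expTerm x j ℚ.* ((ℤ.+ x) ℚ./ suc j)) ℚ.* (ℕ→ℚ (j !) ℚ.* ℕ→ℚ (suc j))   ≡⟨ ℚ-interchange (expTerm x j) _ _ _ ⟩
  (expTerm x j ℚ.* ℕ→ℚ (j !)) ℚ.* (((ℤ.+ x) ℚ./ suc j) ℚ.* ℕ→ℚ (suc j))   ≡⟨ cong₂ ℚ._*_ (expTerm-! x j) (/-cancel x j) ⟩
  ℕ→ℚ (x ^ j) ℚ.* ℕ→ℚ x                                                 ≡⟨ ℕ→ℚ-* (x ^ j) x ⟨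
  ℕ→ℚ (x ^ j * x)                                                       ≡⟨ cong ℕ→ℚ (*-comm (x ^ j) x) ⟩
  ℕ→ℚ (x * x ^ j)                                                       ∎
  where open ≡-Reasoning

-- The index shifts because `expPartial` is indexed by the number of terms, `expSum` by the last
-- exponent.
expPartial-! : ∀ x k → expPartial x (suc k) ℚ.* ℕ→ℚ (k !) ≡ ℕ→ℚ (expSum 1 x k)
expPartial-! x zero = refl
expPartial-! x (suc k) = begin
  (expPartial x (suc k) ℚ.+ expTerm x (suc k)) ℚ.* ℕ→ℚ ((suc k) !)      ≡⟨ ℚ.*-distribʳ-+ (ℕ→ℚ ((suc k) !)) (expPartial x (suc k)) (expTerm x (suc k)) ⟩
  expPartial x (suc k) ℚ.* ℕ→ℚ (suc k * k !) ℚ.+ expTerm x (suc k) ℚ.* ℕ→ℚ ((suc k) !)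
    ≡⟨ cong₂ ℚ._+_ step (expTerm-! x (suc k)) ⟩
  ℕ→ℚ (1 * suc k * expSum 1 x k) ℚ.+ ℕ→ℚ (x ^ suc k)                    ≡⟨ ℕ→ℚ-+ (1 * suc k * expSum 1 x k) (x ^ suc k) ⟨
  ℕ→ℚ (expSum 1 x (suc k))                                              ∎
  where
  open ≡-Reasoning
  eq : ∀ s k → s * k ≡ 1 * k * s
  eq = solve-∀
  step : expPartial x (suc k) ℚ.* ℕ→ℚ (suc k * k !) ≡ ℕ→ℚ (1 * suc k * expSum 1 x k)
  step = begin
    expPartial x (suc k) ℚ.* ℕ→ℚ (suc k * k !)             ≡⟨ cong (expPartial x (suc k) ℚ.*_) (trans (cong ℕ→ℚ (*-comm (suc k) (k !))) (ℕ→ℚ-* (k !) (suc k))) ⟩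
    expPartial x (suc k) ℚ.* (ℕ→ℚ (k !) ℚ.* ℕ→ℚ (suc k))   ≡⟨ ℚ.*-assoc (expPartial x (suc k)) (ℕ→ℚ (k !)) (ℕ→ℚ (suc k)) ⟨
    (expPartial x (suc k) ℚ.* ℕ→ℚ (k !)) ℚ.* ℕ→ℚ (suc k)   ≡⟨ cong (ℚ._* ℕ→ℚ (suc k)) (expPartial-! x k) ⟩
    ℕ→ℚ (expSum 1 x k) ℚ.* ℕ→ℚ (suc k)                     ≡⟨ ℕ→ℚ-* (expSum 1 x k) (suc k) ⟨
    ℕ→ℚ (expSum 1 x k * suc k)                             ≡⟨ cong ℕ→ℚ (eq (expSum 1 x k) (suc k)) ⟩
    ℕ→ℚ (1 * suc k * expSum 1 x k)                         ∎

ExpBound-sound : ∀ {x a b} → ExpBound x a b → ∀ k → ℕ→ℚ b ℚ.* expPartial x k ℚ.≤ ℕ→ℚ a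
ExpBound-sound {x} {a} {b} bound zero = ℚ.≤-trans (ℚ.≤-reflexive (ℚ.*-zeroʳ (ℕ→ℚ b))) (ℕ→ℚ-mono {0} {a} z≤n)
ExpBound-sound {x} {a} {b} bound (suc k) = ℚ.*-cancelʳ-≤-pos (ℕ→ℚ (k !)) {{k!-pos}} (begin
  ℕ→ℚ b ℚ.* expPartial x (suc k) ℚ.* ℕ→ℚ (k !)    ≡⟨ ℚ.*-assoc (ℕ→ℚ b) (expPartial x (suc k)) (ℕ→ℚ (k !)) ⟩
  ℕ→ℚ b ℚ.* (expPartial x (suc k) ℚ.* ℕ→ℚ (k !))  ≡⟨ cong (ℕ→ℚ b ℚ.*_) (expPartial-! x k) ⟩
  ℕ→ℚ b ℚ.* ℕ→ℚ (expSum 1 x k)                    ≡⟨ ℕ→ℚ-* b (expSum 1 x k) ⟨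
  ℕ→ℚ (b * expSum 1 x k)                          ≤⟨ ℕ→ℚ-mono (subst₂ _≤_ (*-comm (expSum 1 x k) b) (*-comm (k !) a) (bound k)) ⟩
  ℕ→ℚ (a * k !)                                   ≡⟨ ℕ→ℚ-* a (k !) ⟩
  ℕ→ℚ a ℚ.* ℕ→ℚ (k !)                             ∎)
  where
  open ℚ.≤-Reasoning
  k!-pos : ℚ.Positive (ℕ→ℚ (k !))
  k!-pos = ℚ.normalize-pos (k !) 1 {{_}} {{>-nonZero (1≤n! k)}}

-- Asymptotics

-- From 7 on, a unit step at most doubles the fifth power: 8^5 ≤ 2 · 7^5, whereas 7^5 > 2 · 6^5.
quintic-growth : ∀ w → (7 + w) ^ 5 ≤ 7 ^ 5 * 2 ^ w
quintic-growth zero = ≤-refl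
quintic-growth (suc w) = begin
  (8 + w) ^ 5                  ≤⟨ m≤m+n _ _ ⟩
  (8 + w) ^ 5 + (w * (w * (w * (w * w))) + 30 * (w * (w * (w * w))) + 340 * (w * (w * w)) + 1740 * (w * w) + 3530 * w + 846)
                               ≡⟨ eq w ⟩
  2 * (7 + w) ^ 5              ≤⟨ *-monoʳ-≤ 2 (quintic-growth w) ⟩
  2 * (7 ^ 5 * 2 ^ w)          ≡⟨ eq₂ (7 ^ 5) (2 ^ w) ⟩
  7 ^ 5 * (2 * 2 ^ w)          ∎
  where
  open ≤-Reasoning
  eq : ∀ w → (8 + w) * ((8 + w) * ((8 + w) * ((8 + w) * ((8 + w) * 1))))
    + (w * (w * (w * (w * w))) + 30 * (w * (w * (w * w))) + 340 * (w * (w * w)) + 1740 * (w * w) + 3530 * w + 846)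
    ≡ 2 * ((7 + w) * ((7 + w) * ((7 + w) * ((7 + w) * ((7 + w) * 1)))))
  eq = solve-∀
  eq₂ : ∀ a b → 2 * (a * b) ≡ a * (2 * b)
  eq₂ = solve-∀

-- The fifth power has one degree to spare: the extra factor w + 1 swallows the constant 7^5 C as
-- soon as w reaches it.
quartic≤exponential : ∀ C → ∃ λ W → ∀ w → W ≤ w → C * suc w ^ 4 ≤ 2 ^ w
quartic≤exponential C = 7 ^ 5 * C , λ w W≤w → *-cancelˡ-≤ (suc w) (begin
  suc w * (C * suc w ^ 4)        ≡⟨ eq (suc w) C (suc w ^ 4) ⟩
  C * suc w ^ 5                  ≤⟨ *-monoʳ-≤ C (^-monoˡ-≤ 5 (+-monoˡ-≤ w (s≤s (z≤n {6})))) ⟩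
  C * (7 + w) ^ 5                ≤⟨ *-monoʳ-≤ C (quintic-growth w) ⟩
  C * (7 ^ 5 * 2 ^ w)            ≡⟨ eq₂ C (7 ^ 5) (2 ^ w) ⟩
  7 ^ 5 * C * 2 ^ w              ≤⟨ *-monoˡ-≤ (2 ^ w) (≤-trans W≤w (n≤1+n w)) ⟩
  suc w * 2 ^ w                  ∎)
  where
  open ≤-Reasoning
  eq : ∀ s c p → s * (c * p) ≡ c * (s * p)
  eq = solve-∀
  eq₂ : ∀ c a p → c * (a * p) ≡ a * c * p
  eq₂ = solve-∀

-- u / v ≥ e and κ uʳ ≤ 1/2, where κ is the product over the L blocks, make Q(n)ᴸ e^{(L + r) n} ≤ n^{L n} for large n.
module Asymptotics (L r u v d : ℕ) (L>0 : 0 < L) (v>0 : 0 < v) (v≤u : v ≤ u) (d>0 : 0 < d)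
  (e≤u/v : v * suc d ^ suc d ≤ u * d ^ suc d)
  (κuʳ≤½ : 2 * Blocks.K L * u ^ r ≤ (8 * (L * L)) ^ L * v ^ r) where

  open Blocks L

  private
    Z = 8 * (L * L)
    u>0 : 0 < u
    u>0 = ≤-trans v>0 v≤u

  -- The w-th power of `κuʳ≤½` trades the block product for (v/u)^(r w) / 2^w. The factor 2^w is the
  -- reserve that pays for all polynomial losses.
  Q-decay : ∀ n w ρ → n ≡ ρ + L * w → 4 ≤ n → Q n * 2 ^ w * (u ^ r) ^ w ≤ ∏₁ n (_+ 3) * (v ^ r) ^ w
  Q-decay n w ρ n≡ 4≤n = *-cancelˡ-≤ (Z ^ (L * w)) {{Z^≢0}} (begin
    Z ^ (L * w) * (Q n * 2 ^ w * (u ^ r) ^ w)          ≡⟨ eq (Z ^ (L * w)) (Q n) (2 ^ w) ((u ^ r) ^ w) ⟩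
    Q n * Z ^ (L * w) * (2 ^ w * (u ^ r) ^ w)          ≤⟨ *-monoˡ-≤ (2 ^ w * (u ^ r) ^ w) (Q-block-bound n w ρ n≡ 4≤n) ⟩
    P * K ^ w * (2 ^ w * (u ^ r) ^ w)                  ≡⟨ eq₂ P (K ^ w) (2 ^ w) ((u ^ r) ^ w) ⟩
    P * (2 ^ w * K ^ w * (u ^ r) ^ w)                  ≡⟨ cong (P *_) (trans (cong (_* (u ^ r) ^ w) (sym (^-distribʳ-* 2 K w))) (sym (^-distribʳ-* (2 * K) (u ^ r) w))) ⟩
    P * (2 * K * u ^ r) ^ w                            ≤⟨ *-monoʳ-≤ P (^-monoˡ-≤ w κuʳ≤½) ⟩
    P * (Z ^ L * v ^ r) ^ w                            ≡⟨ cong (P *_) (trans (^-distribʳ-* (Z ^ L) (v ^ r) w) (cong (_* (v ^ r) ^ w) (^-*-assoc Z L w))) ⟩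
    P * (Z ^ (L * w) * (v ^ r) ^ w)                    ≡⟨ eq₃ P (Z ^ (L * w)) ((v ^ r) ^ w) ⟩
    Z ^ (L * w) * (P * (v ^ r) ^ w)                    ∎)
    where
    open ≤-Reasoning
    P = ∏₁ n (_+ 3)
    Z^≢0 : NonZero (Z ^ (L * w))
    Z^≢0 = m^n≢0 Z (L * w) {{m*n≢0 8 (L * L) {{_}} {{m*n≢0 L L {{>-nonZero L>0}} {{>-nonZero L>0}}}}}}
    eq : ∀ z q t s → z * (q * t * s) ≡ q * z * (t * s)
    eq = solve-∀
    eq₂ : ∀ p k t s → p * k * (t * s) ≡ p * (t * k * s)
    eq₂ = solve-∀
    eq₃ : ∀ p z s → p * (z * s) ≡ z * (p * s)
    eq₃ = solve-∀

  -- What 2^w has to absorb besides (w + 1)^4: the bound ((L + 3)(w + 1))^4 for (ν + 4)^4 leaves (L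
  -- + 3)^4, and the exponent of u is rounded up by 1 + r.
  C : ℕ
  C = (L + 3) ^ 4 * u ^ (1 + r)

  module _ (ν w ρ : ℕ) (n≡ : suc ν ≡ ρ + L * w) (ρ<L : ρ < L) (4≤n : 4 ≤ suc ν) (large : C * suc w ^ 4 ≤ 2 ^ w) where

    private
      n = suc ν

      n≤ : n ≤ L * suc w
      n≤ = ≤-trans (≤-reflexive n≡) (≤-trans (+-monoˡ-≤ (L * w) (<⇒≤ ρ<L)) (≤-reflexive (sym (*-suc L w))))

      polynomial-factor : (ν + 4) ^ 4 * u ^ (1 + r) ≤ 2 ^ w
      polynomial-factor = begin
        (ν + 4) ^ 4 * u ^ (1 + r)                 ≤⟨ *-monoˡ-≤ (u ^ (1 + r)) (^-monoˡ-≤ 4 base) ⟩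
        ((L + 3) * suc w) ^ 4 * u ^ (1 + r)       ≡⟨ cong (_* u ^ (1 + r)) (^-distribʳ-* (L + 3) (suc w) 4) ⟩
        (L + 3) ^ 4 * suc w ^ 4 * u ^ (1 + r)     ≡⟨ eq ((L + 3) ^ 4) (suc w ^ 4) (u ^ (1 + r)) ⟩
        C * suc w ^ 4                             ≤⟨ large ⟩
        2 ^ w                                     ∎
        where
        open ≤-Reasoning
        eq : ∀ a b d → a * b * d ≡ a * d * b
        eq = solve-∀
        base : ν + 4 ≤ (L + 3) * suc w
        base = begin
          ν + 4                      ≡⟨ +-suc ν 3 ⟩
          n + 3                      ≤⟨ +-mono-≤ n≤ (m≤m*n 3 (suc w)) ⟩
          L * suc w + 3 * suc w      ≡⟨ *-distribʳ-+ (suc w) L 3 ⟨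
          (L + 3) * suc w            ∎

      power-split : ∀ t → t ^ (1 + r * suc w) ≡ (t ^ r) ^ w * t ^ (1 + r)
      power-split t = trans (cong (t ^_) (trans (cong suc (*-suc r w)) (+-comm (1 + r) (r * w))))
        (trans (^-distribˡ-+-* t (r * w) (1 + r)) (cong (_* t ^ (1 + r)) (sym (^-*-assoc t r w))))

    Q-bound : Q n * u ^ (1 + r * suc w) ≤ ν ! * v ^ (1 + r * suc w)
    Q-bound = *-cancelʳ-≤ _ _ (2 ^ w) {{m^n≢0 2 w}} (begin
      Q n * u ^ (1 + r * suc w) * 2 ^ w          ≡⟨ cong (λ z → Q n * z * 2 ^ w) (power-split u) ⟩
      Q n * ((u ^ r) ^ w * U) * 2 ^ w            ≡⟨ eq (Q n) ((u ^ r) ^ w) U (2 ^ w) ⟩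
      Q n * 2 ^ w * (u ^ r) ^ w * U              ≤⟨ *-monoˡ-≤ U (Q-decay n w ρ n≡ 4≤n) ⟩
      ∏₁ n (_+ 3) * (v ^ r) ^ w * U              ≤⟨ *-monoˡ-≤ U (*-monoˡ-≤ ((v ^ r) ^ w) (∏₁-shifted-bound ν)) ⟩
      ν ! * (ν + 4) ^ 4 * (v ^ r) ^ w * U        ≡⟨ eq₂ (ν !) ((ν + 4) ^ 4) ((v ^ r) ^ w) U ⟩
      ν ! * (v ^ r) ^ w * ((ν + 4) ^ 4 * U)      ≤⟨ *-monoʳ-≤ (ν ! * (v ^ r) ^ w) polynomial-factor ⟩
      ν ! * (v ^ r) ^ w * 2 ^ w
        ≤⟨ *-monoˡ-≤ (2 ^ w) (*-monoʳ-≤ (ν !) (m≤m*n ((v ^ r) ^ w) (v ^ (1 + r)) {{m^n≢0 v (1 + r) {{>-nonZero v>0}}}})) ⟩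
      ν ! * ((v ^ r) ^ w * v ^ (1 + r)) * 2 ^ w  ≡⟨ cong (λ z → ν ! * z * 2 ^ w) (power-split v) ⟨
      ν ! * v ^ (1 + r * suc w) * 2 ^ w          ∎)
      where
      open ≤-Reasoning
      U = u ^ (1 + r)
      eq : ∀ q a b t → q * (a * b) * t ≡ q * t * a * b
      eq = solve-∀
      eq₂ : ∀ f p a b → f * p * a * b ≡ f * a * (p * b)
      eq₂ = solve-∀

    private
      -- (L + r) n = `e` + L ν, where L ν comes from `ExpBound-factorial` and `e` steps are paid by
      -- u / v. `E` is the exponent in the L-th power of `Q-bound`; it suffices because it was
      -- rounded up to w + 1 blocks.
      e E : ℕ
      e = L + r * n
      E = (1 + r * suc w) * L

      e≤E : e ≤ E
      e≤E = ≤-trans (+-monoʳ-≤ L (*-monoʳ-≤ r n≤)) (≤-reflexive (eq L r (suc w)))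
        where
        eq : ∀ L r s → L + r * (L * s) ≡ (1 + r * s) * L
        eq = solve-∀

    Q-power-bound : Q n ^ L * u ^ e ≤ (ν !) ^ L * v ^ e
    Q-power-bound = let t , e+t≡E = m≤n⇒∃[o]m+o≡n e≤E in *-cancelʳ-≤ _ _ (u ^ t) {{m^n≢0 u t {{>-nonZero u>0}}}} (begin
      Q n ^ L * u ^ e * u ^ t               ≡⟨ join (Q n) u t e+t≡E ⟩
      (Q n * u ^ (1 + r * suc w)) ^ L       ≤⟨ ^-monoˡ-≤ L Q-bound ⟩
      (ν ! * v ^ (1 + r * suc w)) ^ L       ≡⟨ join (ν !) v t e+t≡E ⟨
      (ν !) ^ L * v ^ e * v ^ t             ≤⟨ *-monoʳ-≤ ((ν !) ^ L * v ^ e) (^-monoˡ-≤ t v≤u) ⟩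
      (ν !) ^ L * v ^ e * u ^ t             ∎)
      where
      open ≤-Reasoning
      join : ∀ a b t → e + t ≡ E → a ^ L * b ^ e * b ^ t ≡ (a * b ^ (1 + r * suc w)) ^ L
      join a b t e+t≡E = trans (*-assoc (a ^ L) (b ^ e) (b ^ t)) (trans (cong (a ^ L *_)
        (trans (sym (^-distribˡ-+-* b e t)) (trans (cong (b ^_) e+t≡E) (sym (^-*-assoc b (1 + r * suc w) L)))))
        (sym (^-distribʳ-* a (b ^ (1 + r * suc w)) L)))

    Q-ExpBound : ExpBound ((L + r) * n) (n ^ (L * n)) (Q n ^ L)
    Q-ExpBound k = *-cancelʳ-≤ _ _ (u ^ e) {{m^n≢0 u e {{>-nonZero u>0}}}} (begin
      expSum 1 ((L + r) * n) k * Q n ^ L * u ^ e         ≡⟨ *-assoc (expSum 1 ((L + r) * n) k) (Q n ^ L) (u ^ e) ⟩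
      expSum 1 ((L + r) * n) k * (Q n ^ L * u ^ e)       ≤⟨ *-monoʳ-≤ (expSum 1 ((L + r) * n) k) Q-power-bound ⟩
      expSum 1 ((L + r) * n) k * ((ν !) ^ L * v ^ e)     ≡⟨ cong (λ x → expSum 1 x k * ((ν !) ^ L * v ^ e)) (eq L r ν) ⟩
      expSum 1 (e + L * ν) k * ((ν !) ^ L * v ^ e)       ≤⟨ ExpBound-iterate (ExpBound-ratio d d>0 e≤u/v) e (ExpBound-factorial L ν) k ⟩
      k ! * ((n ^ n) ^ L * u ^ e)
        ≡⟨ cong (λ z → k ! * (z * u ^ e)) (trans (^-*-assoc n n L) (cong (n ^_) (*-comm n L))) ⟩
      k ! * (n ^ (L * n) * u ^ e)                        ≡⟨ *-assoc (k !) (n ^ (L * n)) (u ^ e) ⟨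
      k ! * n ^ (L * n) * u ^ e                          ∎)
      where
      open ≤-Reasoning
      eq : ∀ L r ν → (L + r) * (1 + ν) ≡ L + r * (1 + ν) + L * ν
      eq = solve-∀

  eventually : ∃ λ N → ∀ n → N ≤ n → ExpBound ((L + r) * n) (n ^ (L * n)) (Q n ^ L)
  -- `W * L` brings n / L up to the threshold of the exponential; the 4 is the least board size for
  -- the level bounds.
  eventually = W * L + 4 , λ where
      zero N≤0 → ⊥-elim (<⇒≱ (s≤s z≤n) (≤-trans (m≤n+m 4 (W * L)) N≤0))
      n@(suc ν) N≤n → Q-ExpBound ν (n / L) (n % L)
        (trans (m≡m%n+[m/n]*n n L) (cong (n % L +_) (*-comm (n / L) L))) (m%n<n n L)
        (≤-trans (m≤n+m 4 (W * L)) N≤n)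
        (proj₂ threshold (n / L) (≤-trans (≤-reflexive (sym (m*n/n≡m W L))) (/-monoˡ-≤ L (≤-trans (m≤m+n (W * L) 4) N≤n))))
    where
    instance
      L≢0 : NonZero L
      L≢0 = >-nonZero L>0
    threshold = quartic≤exponential C
    W = proj₁ threshold

-- The bound with explicit constants

exponential-bound : ∀ p q m n → ExpBound (p * n) (n ^ (q * n)) (Q n ^ q) → ∀ k →
  (ℕ→ℚ (Q n ^ q * suc m ^ (q * n)) *ℚ expPartial (p * n) k) ≤ℚ ℕ→ℚ ((suc (suc m) * n) ^ (q * n))
exponential-bound p q m n bound = ExpBound-sound λ k → begin
  expSum 1 (p * n) k * (Q n ^ q * suc m ^ (q * n))   ≡⟨ *-assoc (expSum 1 (p * n) k) (Q n ^ q) _ ⟨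
  expSum 1 (p * n) k * Q n ^ q * suc m ^ (q * n)     ≤⟨ *-mono-≤ (bound k) (^-monoˡ-≤ (q * n) (n≤1+n (suc m))) ⟩
  k ! * n ^ (q * n) * suc (suc m) ^ (q * n)          ≡⟨ *-assoc (k !) (n ^ (q * n)) _ ⟩
  k ! * (n ^ (q * n) * suc (suc m) ^ (q * n))        ≡⟨ cong (k ! *_) (trans (*-comm (n ^ (q * n)) _) (sym (^-distribʳ-* (suc (suc m)) n (q * n)))) ⟩
  k ! * (suc (suc m) * n) ^ (q * n)                  ∎
  where open ≤-Reasoning

-- e ≤ (12000/11999)^12000 ≤ 1699/625
queens-ExpBound : ∃ λ N → ∀ n → N ≤ n → ExpBound ((2930 + 1720) * n) (n ^ (2930 * n)) (Q n ^ 2930)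
queens-ExpBound = Asymptotics.eventually 2930 1720 1699 625 11999
  (≤ᵇ⇒≤ _ _ _) (≤ᵇ⇒≤ _ _ _) (≤ᵇ⇒≤ _ _ _) (≤ᵇ⇒≤ _ _ _) (≤ᵇ⇒≤ _ _ _) (≤ᵇ⇒≤ _ _ _)

theorem3 : Σ ℕ λ p → Σ ℕ λ q → (1 ≤ q) × (1587 * q < 1000 * p) ×
    ((m : ℕ) → ∃ λ N → (n : ℕ) → N ≤ n → 1 ≤ n → (k : ℕ) →
    (ℕ→ℚ (Q n ^ q * suc m ^ (q * n)) *ℚ expPartial (p * n) k)
    ≤ℚ ℕ→ℚ ((suc (suc m) * n) ^ (q * n)))
-- α = p / q = 1 + r / L, with the number L of blocks as the denominator. As ε is 0 beyond the
-- threshold, the same threshold serves every `m`.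
theorem3 = 2930 + 1720 , 2930 , ≤ᵇ⇒≤ _ _ _ , <ᵇ⇒< _ _ _ , λ m →
  proj₁ queens-ExpBound , λ n N≤n _ → exponential-bound (2930 + 1720) 2930 m n (proj₂ queens-ExpBound n N≤n)
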